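{- Let $k$ be a positive integer with $k \equiv 3 \pmod 5$ and let \[ n = L_{CC}(10,k) = \frac{512k^5+1280k^4+6560k^3+7600k^2+4180k+1344}{3125}. \] Then there is an undirected Cayley graph of the cyclic group $\mathbb{Z}_n$ on five generators which has diameter $k$. Moreover, a generating set for such a graph is \[ \Big\{1,\ \tfrac{128k^4+64k^3+1112k^2-1224k-1557}{625},\ \tfrac{256k^4+448k^3+2944k^2+1592k+271}{625},\ \tfrac{256k^4+608k^3+3104k^2+3062k+726}{625},\ \tfrac{384k^4+672k^3+4216k^2+2338k-456}{625}\Big\}, \] i.e. the Cayley graph of $\mathbb{Z}_n$ with connection set $\{\pm g_1,\dots,\pm g_5\}$, where $g_1,\dots,g_5$ are these integers taken modulo $n$, has diameter $k$.
   Context: For a positive integer $n$ and integers $g_1,\dots,g_5$, the undirected Cayley (circulant) graph of the cyclic group $\mathbb{Z}_n$ with generating set $\{g_1,\dots,g_5\}$ has vertex set $\mathbb{Z}_n$, with $i$ and $j$ adjacent if and only if $j-i \equiv \pm g_t \pmod n$ for some $t$. Its diameter is the maximum over pairs of vertices of the graph distance. The notation $L_{CC}(10,k)$ is just a name for the displayed polynomial value. -}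

module Defs where

open import Data.Nat as ℕ using (ℕ; zero; suc; _≤_)
open import Data.Integer as ℤ using (ℤ; +_; _-_)
import Data.Integer.DivMod as ℤD
import Data.Nat.DivMod as ℕD
open import Data.Integer.Divisibility as ℤDiv using ()
open import Data.Fin using (Fin; toℕ)
open import Data.Product using (Σ; ∃; _×_)
open import Data.Sum using (_⊎_)

numL : ℕ → ℕ
numL k = 512 ℕ.* k ℕ.^ 5 ℕ.+ 1280 ℕ.* k ℕ.^ 4 ℕ.+ 6560 ℕ.* k ℕ.^ 3
         ℕ.+ 7600 ℕ.* k ℕ.^ 2 ℕ.+ 4180 ℕ.* k ℕ.+ 1344

-- L_CC(10,k) = numL k / 3125 (exactness is asserted in the theorem).
LCC10 : ℕ → ℕ
LCC10 k = numL k ℕD./ 3125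

numG : ℕ → Fin 5 → ℤ
numG k Fin.zero = + 625
numG k (Fin.suc Fin.zero) =
  (+ 128 ℤ.* x ℤ.^ 4 ℤ.+ + 64 ℤ.* x ℤ.^ 3 ℤ.+ + 1112 ℤ.* x ℤ.^ 2) - (+ 1224 ℤ.* x ℤ.+ + 1557)
  where x = + k
numG k (Fin.suc (Fin.suc Fin.zero)) =
  + 256 ℤ.* x ℤ.^ 4 ℤ.+ + 448 ℤ.* x ℤ.^ 3 ℤ.+ + 2944 ℤ.* x ℤ.^ 2 ℤ.+ + 1592 ℤ.* x ℤ.+ + 271
  where x = + k
numG k (Fin.suc (Fin.suc (Fin.suc Fin.zero))) =
  + 256 ℤ.* x ℤ.^ 4 ℤ.+ + 608 ℤ.* x ℤ.^ 3 ℤ.+ + 3104 ℤ.* x ℤ.^ 2 ℤ.+ + 3062 ℤ.* x ℤ.+ + 726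
  where x = + k
numG k (Fin.suc (Fin.suc (Fin.suc (Fin.suc Fin.zero)))) =
  (+ 384 ℤ.* x ℤ.^ 4 ℤ.+ + 672 ℤ.* x ℤ.^ 3 ℤ.+ + 4216 ℤ.* x ℤ.^ 2 ℤ.+ + 2338 ℤ.* x) - + 456
  where x = + k

-- The generators g_1,...,g_5 (exact division asserted in the theorem).
gen : ℕ → Fin 5 → ℤ
gen k t = numG k t ℤD./ (+ 625)

module _ (n : ℕ) {m : ℕ} (g : Fin m → ℤ) where

  Adj : Fin n → Fin n → Set
  Adj i j = Σ (Fin m) λ t →
    (+ n ℤDiv.∣ ((+ toℕ j - + toℕ i) - g t)) ⊎ (+ n ℤDiv.∣ ((+ toℕ j - + toℕ i) ℤ.+ g t))

  data Walk : ℕ → Fin n → Fin n → Set where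
    here : ∀ {i} → Walk zero i i
    step : ∀ {d i j l} → Adj i j → Walk d j l → Walk (suc d) i l

  HasDiameter : ℕ → Set
  HasDiameter D =
    ((i j : Fin n) → Σ ℕ λ d → d ≤ D × Walk d i j)
    × (Σ (Fin n) λ i → Σ (Fin n) λ j → ∀ d → Walk d i j → D ≤ d)

{-# OPTIONS --safe #-}
module Submission where

open import Defs
open import Data.Bool using (Bool; true; false; _∧_; T)
open import Data.Bool.ListAction using (all; any)
open import Data.Bool.Properties using (T-∧)
open import Data.Fin using (Fin; zero; suc; toℕ; fromℕ<)
open import Data.Fin.Properties using (toℕ-fromℕ<; toℕ-injective; toℕ<n)
open import Data.Integer using
  (ℤ; +_; -_; _+_; _-_; _*_; _⊓_; _⊔_; ∣_∣; 0ℤ; 1ℤ; -1ℤ; _≤_; _<_; _≤ᵇ_; -[1+_]; +[1+_]; +≤+; +<+; -≤+; -≤-; nonNegative)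
import Data.Integer as ℤ
open import Data.Integer.DivMod using (_%ℕ_; _/ℕ_; n%ℕd<d; a≡a%ℕn+[a/ℕn]*n; div-pos-is-/ℕ)
import Data.Integer.Divisibility as Unsigned
open import Data.Integer.Divisibility.Signed using (_∣_; divides; ∣ᵤ⇒∣; ∣⇒∣ᵤ; ∣m∣n⇒∣m+n; ∣m⇒∣-m; ∣n⇒∣m*n)
open import Data.Integer.Properties
open import Data.Integer.Tactic.RingSolver using (solve-∀)
open import Data.List using (List; []; _∷_; upTo; _++_)
import Data.List as List
open import Data.List.Membership.Propositional.Properties using (∈-upTo⁺)
import Data.List.Relation.Unary.All as ListAll
import Data.List.Relation.Unary.All.Properties as ListAll
import Data.List.Relation.Unary.Any as ListAny
import Data.List.Relation.Unary.Any.Properties as ListAny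
open import Data.Maybe using (Maybe; just; nothing)
open import Data.Nat using (ℕ; zero; suc; z≤n; s≤s; NonZero)
import Data.Nat as ℕ
import Data.Nat.Divisibility as ℕ
import Data.Nat.DivMod as ℕ
open import Data.Nat.Induction using (<-wellFounded)
import Data.Nat.Properties as ℕ
import Data.Nat.Tactic.RingSolver as ℕ-Solver
open import Data.Product using (Σ; ∃; _×_; _,_; proj₁; proj₂)
open import Data.Sign using (Sign) renaming (+ to pos; - to neg)
open import Data.Sum using (_⊎_; inj₁; inj₂)
open import Data.Unit using (⊤; tt)
open import Data.Vec using (Vec; []; _∷_; map; zipWith; replicate; lookup; tabulate; updateAt; _[_]≔_)
open import Data.Vec.Properties using
  (lookup-map; lookup-zipWith; lookup-replicate; tabulate∘lookup; tabulate-cong; tabulate-∘; map-∘; map-cong)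
open import Data.Vec.Relation.Binary.Pointwise.Inductive using (Pointwise; []; _∷_)
open import Data.Vec.Relation.Unary.All using (All; []; _∷_)
open import Function using (_∘_; id; Equivalence)
open import Induction.WellFounded using (Acc; acc)
open import Relation.Binary.PropositionalEquality using
  (_≡_; refl; sym; trans; cong; cong₂; subst; subst₂; module ≡-Reasoning)
open import Relation.Nullary using (yes; no)

-- Write k = 5a + 3 and let Λ be the lattice of all x ∈ ℤ⁵ with g · x ≡ 0 (mod n).  A walk of
-- length d from i to j is a vector x with ∥x∥₁ ≤ d and g · x ≡ j − i, so the diameter is the
-- ℓ₁ covering radius of Λ.  The lattice has a basis whose entries are affine in a, and it is a
-- bounded perturbation of (4k/5)(ℤ⁵ ∪ (ℤ⁵ + (½,…,½))).
--
-- Upper bound: every orthant contains an h ∈ Λ near (2k/5)(±1,…,±1) with ∥h∥ = 2k + 1.  If x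
-- lies in the box between 0 and h then ∥x∥ + ∥x − h∥ = 2k + 1, so one of the two is at most k.
-- Otherwise some coordinate of x is large and x can be shortened by a lattice vector near a
-- multiple of a unit vector.  The perturbation makes the boundary cases delicate; they are
-- settled by a decision tree for each orthant, whose leaves are comparisons of affine forms.
--
-- Lower bound: every x ≡ x₀ = (a+1, a+1, a+1, a, a) has ∥x∥ ≥ k.  If ∥x∥ < k, inverting the
-- basis matrix confines the coordinates of x − x₀ in that basis to {−2,…,1}; all 4⁵ are checked.

-- To leading order there is no slack. With L = 4k/5, every point of the box [0, L/2]⁵ whose
-- coordinates sum to 5L/4 = k is at distance exactly k from the unperturbed lattice: a whole
-- four-dimensional slice of deep holes. Hence the constant terms of the lattice vectors decide, and
-- case trees replace an estimate. The determinant L⁵/2 of the unperturbed lattice is the leading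
-- term 512k⁵/3125 of n.
--
-- The claim concerns infinitely many k, so every inequality is one between affine forms or
-- polynomials in the parameter, compared coefficient by coefficient. This suffices for all
-- nonnegative values of the parameter and is decided by evaluation. Passing from a to b = a - 1
-- builds a ≥ 1 into these comparisons; the covering for k = 3 is enumerated.
--
-- The two bounds use the basis differently. The upper bound needs only that its vectors lie in Λ.
-- The lower bound needs that they generate Λ, which an explicit inverse, scaled by n, provides.

-- Integer vectors: ℓ₁ norm, dot products, linear combinations.

norm : ∀ {m} → Vec ℤ m → ℕ
norm []       = 0
norm (x ∷ xs) = ∣ x ∣ ℕ.+ norm xs

sum : ∀ {m} → Vec ℤ m → ℤ
sum []       = 0ℤ
sum (x ∷ xs) = x + sum xs

infixl 6 _⊖ᵛ_
_⊖ᵛ_ : ∀ {m} → Vec ℤ m → Vec ℤ m → Vec ℤ m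
_⊖ᵛ_ = zipWith _-_

≤-from-difference : ∀ {i j d} → 0ℤ ≤ d → j - i ≡ d → i ≤ j
≤-from-difference 0≤d eq = 0≤i-j⇒j≤i (subst (0ℤ ≤_) (sym eq) 0≤d)

0≤-+ : ∀ {i j} → 0ℤ ≤ i → 0ℤ ≤ j → 0ℤ ≤ i + j
0≤-+ = +-mono-≤

∣i∣≤j : ∀ {i j} → i ≤ j → - i ≤ j → + ∣ i ∣ ≤ j
∣i∣≤j {+ _}      i≤j _    = i≤j
∣i∣≤j { -[1+ _ ]} _   -i≤j = -i≤j

dot : ∀ {m} → Vec ℤ m → Vec ℤ m → ℤ
dot []       []       = 0ℤ
dot (g ∷ gs) (x ∷ xs) = g * x + dot gs xs

∣-resp : ∀ {n i j} → n ∣ i → i ≡ j → n ∣ j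
∣-resp n∣i refl = n∣i

dot-zero : ∀ {m} (g : Vec ℤ m) → dot g (replicate m 0ℤ) ≡ 0ℤ
dot-zero []      = refl
dot-zero (g ∷ gs) = cong₂ _+_ (*-zeroʳ g) (dot-zero gs)

norm-zero : ∀ m → norm (replicate m 0ℤ) ≡ 0
norm-zero zero    = refl
norm-zero (suc m) = norm-zero m

dot-updateAt : ∀ {m} (g : Fin m → ℤ) x t s → dot (tabulate g) (updateAt x t (_+_ s)) ≡ s * g t + dot (tabulate g) x
dot-updateAt g (x ∷ xs) zero    s = lemma (g zero) s x (dot (tabulate (g ∘ suc)) xs)
  where
  lemma : ∀ g s x d → g * (s + x) + d ≡ s * g + (g * x + d)
  lemma = solve-∀
dot-updateAt g (x ∷ xs) (suc t) s = trans
  (cong (_+_ (g zero * x)) (dot-updateAt (g ∘ suc) xs t s))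
  (lemma (g zero * x) (s * g (suc t)) (dot (tabulate (g ∘ suc)) xs))
  where
  lemma : ∀ a b c → a + (b + c) ≡ b + (a + c)
  lemma = solve-∀

norm-updateAt : ∀ {m} (x : Vec ℤ m) t s → norm (updateAt x t (_+_ s)) ℕ.≤ ∣ s ∣ ℕ.+ norm x
norm-updateAt (x ∷ xs) zero    s = ℕ.≤-trans (ℕ.+-monoˡ-≤ (norm xs) (∣i+j∣≤∣i∣+∣j∣ s x))
  (ℕ.≤-reflexive (ℕ.+-assoc ∣ s ∣ ∣ x ∣ (norm xs)))
norm-updateAt (x ∷ xs) (suc t) s = ℕ.≤-trans (ℕ.+-monoʳ-≤ ∣ x ∣ (norm-updateAt xs t s))
  (ℕ.≤-reflexive (trans (sym (ℕ.+-assoc ∣ x ∣ ∣ s ∣ (norm xs)))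
    (trans (cong (ℕ._+ norm xs) (ℕ.+-comm ∣ x ∣ ∣ s ∣)) (ℕ.+-assoc ∣ s ∣ ∣ x ∣ (norm xs)))))

infixl 6 _+ᵛ_
infixl 7 _*ᵛ_

_+ᵛ_ : ∀ {m} → Vec ℤ m → Vec ℤ m → Vec ℤ m
_+ᵛ_ = zipWith _+_

_*ᵛ_ : ∀ {m} → ℤ → Vec ℤ m → Vec ℤ m
c *ᵛ x = map (_*_ c) x

dot-+ˡ : ∀ {m} (u v x : Vec ℤ m) → dot (u +ᵛ v) x ≡ dot u x + dot v x
dot-+ˡ []       []       []       = refl
dot-+ˡ (u ∷ us) (v ∷ vs) (x ∷ xs) = trans (cong (_+_ ((u + v) * x)) (dot-+ˡ us vs xs))
  (lemma u v x (dot us xs) (dot vs xs))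
  where
  lemma : ∀ u v x d e → (u + v) * x + (d + e) ≡ (u * x + d) + (v * x + e)
  lemma = solve-∀

dot-*ˡ : ∀ {m} c (u x : Vec ℤ m) → dot (c *ᵛ u) x ≡ c * dot u x
dot-*ˡ c []       []       = sym (*-zeroʳ c)
dot-*ˡ c (u ∷ us) (x ∷ xs) = trans (cong (_+_ (c * u * x)) (dot-*ˡ c us xs)) (lemma c u x (dot us xs))
  where
  lemma : ∀ c u x d → c * u * x + c * d ≡ c * (u * x + d)
  lemma = solve-∀

dot-comm : ∀ {m} (u v : Vec ℤ m) → dot u v ≡ dot v u
dot-comm []       []       = refl
dot-comm (u ∷ us) (v ∷ vs) = cong₂ _+_ (*-comm u v) (dot-comm us vs)

dot-+ʳ : ∀ {m} (g u v : Vec ℤ m) → dot g (u +ᵛ v) ≡ dot g u + dot g v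
dot-+ʳ g u v = trans (dot-comm g (u +ᵛ v)) (trans (dot-+ˡ u v g) (cong₂ _+_ (dot-comm u g) (dot-comm v g)))

dot-*ʳ : ∀ {m} c (g u : Vec ℤ m) → dot g (c *ᵛ u) ≡ c * dot g u
dot-*ʳ c g u = trans (dot-comm g (c *ᵛ u)) (trans (dot-*ˡ c u g) (cong (_*_ c) (dot-comm u g)))

dot-- : ∀ {m} (g x y : Vec ℤ m) → dot g (x ⊖ᵛ y) ≡ dot g x - dot g y
dot-- []       []       []       = refl
dot-- (g ∷ gs) (x ∷ xs) (y ∷ ys) = trans (cong (_+_ (g * (x - y))) (dot-- gs xs ys))
  (lemma g x y (dot gs xs) (dot gs ys))
  where
  lemma : ∀ g x y d e → g * (x - y) + (d - e) ≡ (g * x + d) - (g * y + e)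
  lemma = solve-∀

combℤ : ∀ {m n} → Vec ℤ m → Vec (Vec ℤ n) m → Vec ℤ n
combℤ []       []       = replicate _ 0ℤ
combℤ (c ∷ cs) (b ∷ bs) = c *ᵛ b +ᵛ combℤ cs bs

dot-combℤ : ∀ {m n} (cs : Vec ℤ m) (bs : Vec (Vec ℤ n) m) y → dot (combℤ cs bs) y ≡ dot cs (map (λ b → dot b y) bs)
dot-combℤ []       []       y = trans (dot-comm _ y) (dot-zero y)
dot-combℤ (c ∷ cs) (b ∷ bs) y = trans (dot-+ˡ (c *ᵛ b) (combℤ cs bs) y)
  (cong₂ _+_ (dot-*ˡ c b y) (dot-combℤ cs bs y))

lookup-combℤ : ∀ {m n} (cs : Vec ℤ m) (bs : Vec (Vec ℤ n) m) r →
               lookup (combℤ cs bs) r ≡ dot cs (map (λ b → lookup b r) bs)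
lookup-combℤ []       []       r = lookup-replicate r 0ℤ
lookup-combℤ (c ∷ cs) (b ∷ bs) r = trans (lookup-zipWith _+_ r (c *ᵛ b) (combℤ cs bs))
  (cong₂ _+_ (lookup-map r (_*_ c) b) (lookup-combℤ cs bs r))

unit : ∀ {m} → Fin m → Vec ℤ m
unit {suc m} zero    = 1ℤ ∷ replicate m 0ℤ
unit {suc m} (suc r) = 0ℤ ∷ unit r

dot-unit : ∀ {m} (r : Fin m) y → dot (unit r) y ≡ lookup y r
dot-unit zero    (y ∷ ys) = trans (cong₂ _+_ (*-identityˡ y) (trans (dot-comm _ ys) (dot-zero ys))) (+-identityʳ y)
dot-unit (suc r) (y ∷ ys) = trans (cong₂ _+_ (*-zeroˡ y) (dot-unit r ys)) (+-identityˡ _)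

-- Walks in the circulant graph as integer vectors.

module Cayley (n : ℕ) .{{_ : NonZero n}} {m : ℕ} (g : Fin m → ℤ) where

  infix 4 _≋_
  -- A record and not a synonym, so that unification recovers the two sides, which could not be read
  -- off from the difference i - j.
  record _≋_ (i j : ℤ) : Set where
    constructor ≋-intro
    field difference : + n ∣ i - j
  open _≋_

  ≋-trans : ∀ {i j k} → i ≋ j → j ≋ k → i ≋ k
  ≋-trans {i} {j} {k} (≋-intro p) (≋-intro q) = ≋-intro (∣-resp (∣m∣n⇒∣m+n p q) (lemma i j k))
    where
    lemma : ∀ i j k → (i - j) + (j - k) ≡ i - k
    lemma = solve-∀

  ≋-sym : ∀ {i j} → i ≋ j → j ≋ i
  ≋-sym {i} {j} (≋-intro p) = ≋-intro (∣-resp (∣m⇒∣-m p) (lemma i j))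
    where
    lemma : ∀ i j → - (i - j) ≡ j - i
    lemma = solve-∀

  ≋-reflexive : ∀ {i j} → i ≡ j → i ≋ j
  ≋-reflexive {i} refl = ≋-intro (divides 0ℤ (i≡j⇒i-j≡0 {i} refl))

  ≋-cong-- : ∀ {i i′ j j′} → i ≋ i′ → j ≋ j′ → i - j ≋ i′ - j′
  ≋-cong-- {i} {i′} {j} {j′} (≋-intro p) (≋-intro q) =
    ≋-intro (∣-resp (∣m∣n⇒∣m+n p (∣m⇒∣-m q)) (lemma i i′ j j′))
    where
    lemma : ∀ i i′ j j′ → (i - i′) + - (j - j′) ≡ (i - j) - (i′ - j′)
    lemma = solve-∀

  vertex : ℤ → Fin n
  vertex z = fromℕ< (n%ℕd<d z n)

  %ℕ-≋ : ∀ z → + (z %ℕ n) ≋ z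
  %ℕ-≋ z = ≋-intro (divides (- (z /ℕ n))
    (trans (cong (λ e → + (z %ℕ n) - e) (a≡a%ℕn+[a/ℕn]*n z n)) (lemma (+ (z %ℕ n)) (z /ℕ n) (+ n))))
    where
    lemma : ∀ r q n → r - (r + q * n) ≡ - q * n
    lemma = solve-∀

  toℕ-vertex : ∀ z → + toℕ (vertex z) ≋ z
  toℕ-vertex z rewrite toℕ-fromℕ< (n%ℕd<d z n) = %ℕ-≋ z

  residue-unique : ∀ {r s} → r ℕ.< n → s ℕ.< n → + r ≋ + s → r ≡ s
  residue-unique {r} {s} r<n s<n p = +-injective (i-j≡0⇒i≡j (+ r) (+ s) (∣i∣≡0⇒i≡0 zero-distance))
    where
    distance<n : ∣ + r - + s ∣ ℕ.< n
    distance<n = ℕ.≤-<-trans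
      (subst (λ e → ∣ e ∣ ℕ.≤ r ℕ.⊔ s) (sym (m-n≡m⊖n r s)) (∣m⊝n∣≤m⊔n r s))
      (ℕ.⊔-lub r<n s<n)
    zero-distance : ∣ + r - + s ∣ ≡ 0
    zero-distance with ∣ + r - + s ∣ | distance<n | ∣⇒∣ᵤ (difference p)
    ... | zero  | _   | _   = refl
    ... | suc d | d<n | n∣d with () ← ℕ.<⇒≱ d<n (ℕ.∣⇒≤ n∣d)

  vertex-cong : ∀ {z z′} → z ≋ z′ → vertex z ≡ vertex z′
  vertex-cong {z} {z′} p = toℕ-injective (residue-unique (toℕ<n (vertex z)) (toℕ<n (vertex z′))
    (≋-trans (toℕ-vertex z) (≋-trans p (≋-sym (toℕ-vertex z′)))))

  vertex-toℕ : ∀ i → vertex (+ toℕ i) ≡ i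
  vertex-toℕ i = toℕ-injective (residue-unique (toℕ<n _) (toℕ<n i) (toℕ-vertex (+ toℕ i)))

  _++ʷ_ : ∀ {d e i j l} → Walk n g d i j → Walk n g e j l → Walk n g (d ℕ.+ e) i l
  here     ++ʷ v = v
  step a w ++ʷ v = step a (w ++ʷ v)

  step⁺ : ∀ t z → Adj n g (vertex z) (vertex (z + g t))
  step⁺ t z = t , inj₁ (∣⇒∣ᵤ (∣-resp (difference (≋-cong-- (toℕ-vertex (z + g t)) (toℕ-vertex z)))
      (lemma (+ toℕ (vertex (z + g t))) (+ toℕ (vertex z)) z (g t))))
    where
    lemma : ∀ i j z g → (i - j) - ((z + g) - z) ≡ (i - j) - g
    lemma = solve-∀

  step⁻ : ∀ t z → Adj n g (vertex z) (vertex (z + - g t))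
  step⁻ t z = t , inj₂ (∣⇒∣ᵤ (∣-resp (difference (≋-cong-- (toℕ-vertex (z + - g t)) (toℕ-vertex z)))
      (lemma (+ toℕ (vertex (z + - g t))) (+ toℕ (vertex z)) z (g t))))
    where
    lemma : ∀ i j z g → (i - j) - ((z + - g) - z) ≡ (i - j) + g
    lemma = solve-∀

  iterate-step : ∀ s → (∀ z → Adj n g (vertex z) (vertex (z + s))) →
                 ∀ d z → Walk n g d (vertex z) (vertex (z + s * + d))
  iterate-step s adj zero    z = subst (λ e → Walk n g 0 (vertex z) (vertex e)) (lemma z s) here
    where
    lemma : ∀ z s → z ≡ z + s * 0ℤ
    lemma = solve-∀
  iterate-step s adj (suc d) z = step (adj z)
    (subst (λ e → Walk n g d (vertex (z + s)) (vertex e)) (lemma z s (+ d)) (iterate-step s adj d (z + s)))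
    where
    lemma : ∀ z s d → (z + s) + s * d ≡ z + s * (1ℤ + d)
    lemma = solve-∀

  walk-along : ∀ t c z → Walk n g ∣ c ∣ (vertex z) (vertex (z + g t * c))
  walk-along t (+ d)      z = iterate-step (g t) (step⁺ t) d z
  walk-along t (-[1+ d ]) z = subst (λ e → Walk n g (suc d) (vertex z) (vertex (z + e))) (lemma (g t) (+ suc d))
    (iterate-step (- g t) (step⁻ t) (suc d) z)
    where
    lemma : ∀ g d → - g * d ≡ g * - d
    lemma = solve-∀

  -- The reindexing f lets the induction run over a final segment of the generators while the graph
  -- stays fixed.
  walk-vector : ∀ {m′} (f : Fin m′ → Fin m) x z →
                Walk n g (norm x) (vertex z) (vertex (z + dot (tabulate (g ∘ f)) x))
  walk-vector f []       z = subst (λ e → Walk n g 0 (vertex z) (vertex e)) (sym (+-identityʳ z)) here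
  walk-vector f (x ∷ xs) z = walk-along (f zero) x z ++ʷ
    subst (λ e → Walk n g (norm xs) (vertex (z + g (f zero) * x)) (vertex e))
      (+-assoc z (g (f zero) * x) (dot (tabulate (g ∘ f ∘ suc)) xs))
      (walk-vector (f ∘ suc) xs (z + g (f zero) * x))

  -- The group is abelian, so the displacement depends only on the signed count of each generator;
  -- cancellation can only lower the norm.
  walk⇒vector : ∀ {d i j} → Walk n g d i j →
                ∃ λ x → norm x ℕ.≤ d × dot (tabulate g) x ≋ + toℕ j - + toℕ i
  walk⇒vector {i = i} here = replicate m 0ℤ , ℕ.≤-reflexive (norm-zero m) ,
    ≋-reflexive (trans (dot-zero (tabulate g)) (sym (i≡j⇒i-j≡0 {+ toℕ i} refl)))
  walk⇒vector {suc d} {i} {l} (step {j = j} (t , adj) w) with walk⇒vector w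
  ... | x , ∣x∣≤d , p = extend adj
    where
    signed-step : ∀ s → ∣ s ∣ ≡ 1 → + n ∣ (+ toℕ j - + toℕ i) - s * g t →
                  ∃ λ y → norm y ℕ.≤ suc d × dot (tabulate g) y ≋ + toℕ l - + toℕ i
    signed-step s ∣s∣≡1 q = updateAt x t (_+_ s) ,
      ℕ.≤-trans (norm-updateAt x t s) (subst (λ e → e ℕ.+ norm x ℕ.≤ suc d) (sym ∣s∣≡1) (s≤s ∣x∣≤d)) ,
      ≋-intro (∣-resp (∣m∣n⇒∣m+n (difference p) (∣m⇒∣-m q))
        (trans (lemma (dot (tabulate g) x) (+ toℕ l) (+ toℕ j) (+ toℕ i) (s * g t))
               (cong (_- (+ toℕ l - + toℕ i)) (sym (dot-updateAt g x t s)))))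
      where
      lemma : ∀ d l j i s → (d - (l - j)) + - ((j - i) - s) ≡ (s + d) - (l - i)
      lemma = solve-∀
    lemma⁺ : ∀ a g → a - g ≡ a - 1ℤ * g
    lemma⁺ = solve-∀
    lemma⁻ : ∀ a g → a + g ≡ a - -1ℤ * g
    lemma⁻ = solve-∀
    extend : _ → ∃ λ y → norm y ℕ.≤ suc d × dot (tabulate g) y ≋ + toℕ l - + toℕ i
    extend (inj₁ q) = signed-step 1ℤ refl (∣-resp (∣ᵤ⇒∣ q) (lemma⁺ (+ toℕ j - + toℕ i) (g t)))
    extend (inj₂ q) = signed-step -1ℤ refl (∣-resp (∣ᵤ⇒∣ q) (lemma⁻ (+ toℕ j - + toℕ i) (g t)))

  Covering : ℕ → Set
  Covering D = ∀ z → ∃ λ x → norm x ℕ.≤ D × dot (tabulate g) x ≋ z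

  Hole : ℕ → Set
  Hole D = ∃ λ z → ∀ x → dot (tabulate g) x ≋ z → D ℕ.≤ norm x

  -- By translation only the difference j - i matters, so the distant pair may start at 0.
  hasDiameter : ∀ {D} → Covering D → Hole D → HasDiameter n g D
  hasDiameter {D} cover (z₀ , far) = near , vertex 0ℤ , vertex z₀ , λ d w →
      let x , ∣x∣≤d , p = walk⇒vector w in
      ℕ.≤-trans (far x (≋-trans p (≋-trans (≋-cong-- (toℕ-vertex z₀) (toℕ-vertex 0ℤ))
        (≋-reflexive (+-identityʳ z₀))))) ∣x∣≤d
    where
    near : ∀ i j → ∃ λ d → d ℕ.≤ D × Walk n g d i j
    near i j with cover (+ toℕ j - + toℕ i)
    ... | x , ∣x∣≤D , p = norm x , ∣x∣≤D ,
      subst₂ (Walk n g (norm x)) (vertex-toℕ i)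
        (trans (vertex-cong {+ toℕ i + dot (tabulate g) x} {+ toℕ j}
          (≋-intro (∣-resp (difference p) (lemma (dot (tabulate g) x) (+ toℕ j) (+ toℕ i))))) (vertex-toℕ j))
        (walk-vector id x (+ toℕ i))
      where
      lemma : ∀ d j i → d - (j - i) ≡ (i + d) - j
      lemma = solve-∀

-- Affine forms in a natural parameter, and decision trees.

infix 5 _t+_
record Lin : Set where
  constructor _t+_
  field
    slope intercept : ℤ

infixl 6 _⊕_ _⊝_
_⊕_ _⊝_ minᶠ maxᶠ : Lin → Lin → Lin
(p t+ q) ⊕ (p′ t+ q′) = (p + p′) t+ (q + q′)
(p t+ q) ⊝ (p′ t+ q′) = (p - p′) t+ (q - q′)
-- Coefficientwise, so only bounds for the pointwise minimum and maximum over t ≥ 0.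
minᶠ (p t+ q) (p′ t+ q′) = (p ⊓ p′) t+ (q ⊓ q′)
maxᶠ (p t+ q) (p′ t+ q′) = (p ⊔ p′) t+ (q ⊔ q′)

0ᶠ 1ᶠ : Lin
0ᶠ = 0ℤ t+ 0ℤ
1ᶠ = 0ℤ t+ 1ℤ

Σᶠ : ∀ {m} → Vec Lin m → Lin
Σᶠ []       = 0ᶠ
Σᶠ (f ∷ fs) = f ⊕ Σᶠ fs

-- An affine form is nonnegative at every t ≥ 0 exactly when slope and intercept both are, so this
-- comparison loses nothing.
_≤ᶠ_ : Lin → Lin → Bool
(p t+ q) ≤ᶠ (p′ t+ q′) = (p ≤ᵇ p′) ∧ (q ≤ᵇ q′)

module Evaluation (t : ℕ) where

  ev : Lin → ℤ
  ev (p t+ q) = p * + t + q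

  ev-⊕ : ∀ f g → ev (f ⊕ g) ≡ ev f + ev g
  ev-⊕ (p t+ q) (p′ t+ q′) = lemma p q p′ q′ (+ t)
    where
    lemma : ∀ p q p′ q′ t → (p + p′) * t + (q + q′) ≡ p * t + q + (p′ * t + q′)
    lemma = solve-∀

  ev-⊝ : ∀ f g → ev (f ⊝ g) ≡ ev f - ev g
  ev-⊝ (p t+ q) (p′ t+ q′) = lemma p q p′ q′ (+ t)
    where
    lemma : ∀ p q p′ q′ t → (p - p′) * t + (q - q′) ≡ p * t + q - (p′ * t + q′)
    lemma = solve-∀

  ev-mono : ∀ {p q p′ q′} → p ≤ p′ → q ≤ q′ → ev (p t+ q) ≤ ev (p′ t+ q′)
  ev-mono p≤p′ q≤q′ = +-mono-≤ (*-monoʳ-≤-nonNeg (+ t) p≤p′) q≤q′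

  ≤ᶠ-sound : ∀ f g → T (f ≤ᶠ g) → ev f ≤ ev g
  ≤ᶠ-sound (p t+ q) (p′ t+ q′) f≤g =
    let p≤p′ , q≤q′ = Equivalence.to (T-∧ {p ≤ᵇ p′} {q ≤ᵇ q′}) f≤g
    in ev-mono {p} {q} {p′} {q′} (≤ᵇ⇒≤ p≤p′) (≤ᵇ⇒≤ q≤q′)

  minᶠ≤ˡ : ∀ f g → ev (minᶠ f g) ≤ ev f
  minᶠ≤ˡ (p t+ q) (p′ t+ q′) = ev-mono (i⊓j≤i p p′) (i⊓j≤i q q′)

  minᶠ≤ʳ : ∀ f g → ev (minᶠ f g) ≤ ev g
  minᶠ≤ʳ (p t+ q) (p′ t+ q′) = ev-mono (i⊓j≤j p p′) (i⊓j≤j q q′)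

  ≤maxᶠˡ : ∀ f g → ev f ≤ ev (maxᶠ f g)
  ≤maxᶠˡ (p t+ q) (p′ t+ q′) = ev-mono (i≤i⊔j p p′) (i≤i⊔j q q′)

  ≤maxᶠʳ : ∀ f g → ev g ≤ ev (maxᶠ f g)
  ≤maxᶠʳ (p t+ q) (p′ t+ q′) = ev-mono (i≤j⊔i p p′) (i≤j⊔i q q′)

  ev-1 : ev 1ᶠ ≡ 1ℤ
  ev-1 = cong (_+ 1ℤ) (*-zeroˡ (+ t))

  ev-0 : ev 0ᶠ ≡ 0ℤ
  ev-0 = cong (_+ 0ℤ) (*-zeroˡ (+ t))

-- y − |y − w| = min(w, 2y − w) is monotone in y.
gain : Lin → Lin → Lin
gain w l = minᶠ w (l ⊕ l ⊝ w)

-- |y − w| = (w − y) + 2 max(0, y − w), and the last summand is monotone in y.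
overshoot : Lin → Lin → Lin
overshoot w u = maxᶠ 0ᶠ (u ⊝ w)

gains : ∀ {m} → Vec Lin m → Vec Lin m → Lin
gains w l = Σᶠ (zipWith gain w l)

overshoots : ∀ {m} → Vec Lin m → Vec (Maybe Lin) m → Maybe Lin
overshoots []       []             = just 0ᶠ
overshoots (w ∷ ws) (nothing ∷ us) = nothing
overshoots (w ∷ ws) (just u ∷ us) with overshoots ws us
... | nothing = nothing
... | just o  = just (overshoot w u ⊕ o)

-- split i p q s t distinguishes y i ≤ p t + q (tree s) from y i > p t + q (tree t);
-- the leaves ↓ j and ↻ j subtract the j-th vector w of a list of lattice vectors:
-- ↓ shortens y because its coordinates are large, while ↻ brings it below the radius κ
-- because they are small: ∥y − w∥ ≤ Σ w − ∥y∥ + 2 Σ max(0, y i − w i) and ∥y∥ > κ.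
data Tree (m : ℕ) : Set where
  split            : Fin m → ℕ → ℕ → Tree m → Tree m → Tree m
  ↓ ↻ : ℕ → Tree m

threshold : ℕ → ℕ → Lin
threshold p q = + p t+ + q

pick : {A : Set} → A → List A → ℕ → A
pick d []       _       = d
pick d (x ∷ _)  zero    = x
pick d (_ ∷ xs) (suc j) = pick d xs j

pick-All : {A : Set} {P : A → Set} {d : A} {xs : List A} → P d → ListAll.All P xs → ∀ j → P (pick d xs j)
pick-All pd ListAll.[]         _       = pd
pick-All pd (px ListAll.∷ _)   zero    = px
pick-All pd (_ ListAll.∷ pxs)  (suc j) = pick-All pd pxs j

-- Checking a decision tree, and soundness of the check.

module Check {m : ℕ} (κ : Lin) where

  -- The gains bound Σ y - ∥y - w∥ from below; by integrality a total of 1 expresses strict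
  -- decrease.
  shortens : Vec Lin m → Vec Lin m → Bool
  shortens w l = 1ᶠ ≤ᶠ gains w l

  reflects : Vec Lin m → Vec (Maybe Lin) m → Bool
  reflects w u with overshoots w u
  ... | nothing = false
  ... | just o  = (Σᶠ w ⊕ (o ⊕ o)) ≤ᶠ (κ ⊕ κ ⊕ 1ᶠ)

  -- A split overwrites any earlier bound on its coordinate. Every true bound is sound; choosing
  -- sharper ones is left to the tree.
  check : Vec Lin m → List (Vec Lin m) → Vec Lin m → Vec (Maybe Lin) m → Tree m → Bool
  check d ws l u (split i p q s t) =
    check d ws l (u [ i ]≔ just (threshold p q)) s ∧
    check d ws (l [ i ]≔ (threshold p q ⊕ 1ᶠ)) u t
  check d ws l u (↓ j) = shortens (pick d ws j) l
  check d ws l u (↻ j) = reflects (pick d ws j) u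

  module Sound (t : ℕ) where
    open Evaluation t

    _≥ˡ_ : Lin → ℤ → Set
    l ≥ˡ y = ev l ≤ y

    _≤ᵘ_ : Maybe Lin → ℤ → Set
    nothing ≤ᵘ y = ⊤
    just u  ≤ᵘ y = y ≤ ev u

    gain-bound : ∀ w l y → ev l ≤ y → + ∣ y - ev w ∣ ≤ y - ev (gain w l)
    gain-bound w l y l≤y = ∣i∣≤j
      (+-monoʳ-≤ y (neg-mono-≤ (minᶠ≤ˡ w _)))
      (≤-from-difference
        (0≤-+ (i≤j⇒0≤j-i (minᶠ≤ʳ w (l ⊕ l ⊝ w))) (0≤-+ (i≤j⇒0≤j-i l≤y) (i≤j⇒0≤j-i l≤y)))
        (trans (lemma y (ev w) (ev l) (ev (gain w l)))
               (cong (λ e → e - ev (gain w l) + (y - ev l + (y - ev l))) (sym ev-2l-w))))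
      where
      ev-2l-w : ev (l ⊕ l ⊝ w) ≡ ev l + ev l - ev w
      ev-2l-w = trans (ev-⊝ (l ⊕ l) w) (cong (_- ev w) (ev-⊕ l l))
      lemma : ∀ y w l g → (y - g) - - (y - w) ≡ (l + l - w) - g + ((y - l) + (y - l))
      lemma = solve-∀

    gains-bound : ∀ {n} (w l : Vec Lin n) y → Pointwise _≥ˡ_ l y →
                  + norm (y ⊖ᵛ map ev w) ≤ sum y - ev (gains w l)
    gains-bound []       []       []       []        rewrite ev-0 = ≤-refl
    gains-bound (w ∷ ws) (l ∷ ls) (y ∷ ys) (p ∷ ps) =
      ≤-trans (+-mono-≤ (gain-bound w l y p) (gains-bound ws ls ys ps))
        (≤-reflexive (trans (lemma y (sum ys) (ev (gain w l)) (ev (gains ws ls)))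
          (cong (λ e → y + sum ys - e) (sym (ev-⊕ (gain w l) (gains ws ls))))))
      where
      lemma : ∀ y s g h → (y - g) + (s - h) ≡ (y + s) - (g + h)
      lemma = solve-∀

    overshoot-bound : ∀ w u y → y ≤ ev u → + ∣ y - ev w ∣ ≤ ev w - y + (ev (overshoot w u) + ev (overshoot w u))
    overshoot-bound w u y y≤u = ∣i∣≤j
      (≤-from-difference (0≤-+ y-w≤o y-w≤o) (lemma₁ y (ev w) (ev (overshoot w u))))
      (≤-from-difference (0≤-+ 0≤o 0≤o) (lemma₂ y (ev w) (ev (overshoot w u))))
      where
      0≤o : 0ℤ ≤ ev (overshoot w u)
      0≤o = ≤-trans (≤-reflexive (sym ev-0)) (≤maxᶠˡ 0ᶠ (u ⊝ w))
      y-w≤o : 0ℤ ≤ ev (overshoot w u) - (y - ev w)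
      y-w≤o = i≤j⇒0≤j-i (≤-trans (+-monoˡ-≤ (- ev w) y≤u)
        (≤-trans (≤-reflexive (sym (ev-⊝ u w))) (≤maxᶠʳ 0ᶠ (u ⊝ w))))
      lemma₁ : ∀ y w o → (w - y + (o + o)) - (y - w) ≡ (o - (y - w)) + (o - (y - w))
      lemma₁ = solve-∀
      lemma₂ : ∀ y w o → (w - y + (o + o)) - - (y - w) ≡ o + o
      lemma₂ = solve-∀

    overshoots-bound : ∀ {n} (w : Vec Lin n) u y {o} → overshoots w u ≡ just o → Pointwise _≤ᵘ_ u y →
                       + norm (y ⊖ᵛ map ev w) ≤ ev (Σᶠ w) - sum y + (ev o + ev o)
    overshoots-bound []       []            []       refl []       rewrite ev-0 = ≤-refl
    overshoots-bound (w ∷ ws) (just u ∷ us) (y ∷ ys) eq (p ∷ ps) with overshoots ws us in eqs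
    overshoots-bound (w ∷ ws) (just u ∷ us) (y ∷ ys) refl (p ∷ ps) | just o =
      ≤-trans (+-mono-≤ (overshoot-bound w u y p) (overshoots-bound ws us ys eqs ps))
        (≤-reflexive (trans (lemma (ev w) y (ev (overshoot w u)) (ev (Σᶠ ws)) (sum ys) (ev o))
          (cong₂ (λ e f → e - (y + sum ys) + (f + f))
            (sym (ev-⊕ w (Σᶠ ws))) (sym (ev-⊕ (overshoot w u) o)))))
      where
      lemma : ∀ w y o w′ y′ o′ → (w - y + (o + o)) + (w′ - y′ + (o′ + o′))
        ≡ (w + w′) - (y + y′) + ((o + o′) + (o + o′))
      lemma = solve-∀

    Shortens Reflects : Vec ℤ m → Vec Lin m → Set
    Shortens y w = + norm (y ⊖ᵛ map ev w) < sum y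
    Reflects y w = + norm (y ⊖ᵛ map ev w) ≤ ev κ

    shortens-sound : ∀ w l y → T (shortens w l) → Pointwise _≥ˡ_ l y → Shortens y w
    shortens-sound w l y ok p = ≤-<-trans (gains-bound w l y p)
      (suc[i]≤j⇒i<j (≤-from-difference (i≤j⇒0≤j-i 1≤g) (lemma (sum y) (ev (gains w l)))))
      where
      1≤g : 1ℤ ≤ ev (gains w l)
      1≤g = ≤-trans (≤-reflexive (sym ev-1)) (≤ᶠ-sound 1ᶠ (gains w l) ok)
      lemma : ∀ s g → s - (1ℤ + (s - g)) ≡ g - 1ℤ
      lemma = solve-∀

    reflects-sound : ∀ w u y → T (reflects w u) → ev κ < sum y → Pointwise _≤ᵘ_ u y → Reflects y w
    reflects-sound w u y ok κ<y p with overshoots w u in eq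
    ... | just o = ≤-trans (overshoots-bound w u y eq p)
      (≤-from-difference (0≤-+ (i≤j⇒0≤j-i bound) (i≤j⇒0≤j-i (i<j⇒suc[i]≤j κ<y)))
        (lemma (ev κ) (ev (Σᶠ w)) (sum y) (ev o)))
      where
      bound : ev (Σᶠ w) + (ev o + ev o) ≤ ev κ + ev κ + 1ℤ
      bound = ≤-trans
        (≤-reflexive (trans (cong (_+_ (ev (Σᶠ w))) (sym (ev-⊕ o o))) (sym (ev-⊕ (Σᶠ w) (o ⊕ o)))))
        (≤-trans (≤ᶠ-sound (Σᶠ w ⊕ (o ⊕ o)) (κ ⊕ κ ⊕ 1ᶠ) ok)
        (≤-reflexive (trans (ev-⊕ (κ ⊕ κ) 1ᶠ) (cong₂ _+_ (ev-⊕ κ κ) ev-1))))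
      lemma : ∀ k w y o → k - (w - y + (o + o)) ≡ (k + k + 1ℤ - (w + (o + o))) + (y - (1ℤ + k))
      lemma = solve-∀

    update : ∀ {A : Set} {_∼_ : A → ℤ → Set} {n} {xs : Vec A n} {ys : Vec ℤ n} (i : Fin n) {x} →
             x ∼ lookup ys i → Pointwise _∼_ xs ys → Pointwise _∼_ (xs [ i ]≔ x) ys
    update zero    q (_ ∷ ps) = q ∷ ps
    update (suc i) q (p ∷ ps) = p ∷ update i q ps

    -- The predicate P keeps the search independent of the lattice: each candidate, the default
    -- included, comes with its certificate, and the chosen one brings it along.
    check-sound : {P : Vec Lin m → Set} → ∀ {d ws} → P d → ListAll.All P ws →
                  ∀ {l u} y tree → T (check d ws l u tree) → ev κ < sum y →
                  Pointwise _≥ˡ_ l y → Pointwise _≤ᵘ_ u y →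
                  Σ (Vec Lin m) λ w → P w × (Shortens y w ⊎ Reflects y w)
    check-sound Pd Pws y (split i p q s t) ok κ<y l≤y y≤u
      with Equivalence.to T-∧ ok | lookup y i ≤? ev (threshold p q)
    ... | ok₁ , _ | yes y≤c = check-sound Pd Pws y s ok₁ κ<y l≤y (update {_∼_ = _≤ᵘ_} i y≤c y≤u)
    ... | _ , ok₂ | no  y≰c = check-sound Pd Pws y t ok₂ κ<y (update {_∼_ = _≥ˡ_} i c<y l≤y) y≤u
      where
      -- Integrality: the failure of y ≤ c means y ≥ c + 1, the bound recorded by `check`.
      c<y : ev (threshold p q ⊕ 1ᶠ) ≤ lookup y i
      c<y = ≤-trans (≤-reflexive (trans (ev-⊕ (threshold p q) 1ᶠ)
              (trans (cong (_+_ (ev (threshold p q))) ev-1) (+-comm (ev (threshold p q)) 1ℤ))))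
              (i<j⇒suc[i]≤j (≰⇒> y≰c))
    check-sound Pd Pws y (↓ j) ok κ<y l≤y y≤u =
      _ , pick-All Pd Pws j , inj₁ (shortens-sound _ _ y ok l≤y)
    check-sound Pd Pws y (↻ j) ok κ<y l≤y y≤u =
      _ , pick-All Pd Pws j , inj₂ (reflects-sound _ _ y ok κ<y y≤u)

-- The lattice basis, the vectors at the leaves, and the sixteen trees.

infixl 7 _·ᶠ_
_·ᶠ_ : ℤ → Lin → Lin
c ·ᶠ (p t+ q) = (c * p) t+ (c * q)

comb : ∀ {m n} → Vec ℤ m → Vec (Vec Lin n) m → Vec Lin n
comb []       []       = replicate _ 0ᶠ
comb (c ∷ cs) (b ∷ bs) = zipWith _⊕_ (map (c ·ᶠ_) b) (comb cs bs)

-- Forms in a, where k = 5a + 3.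
basis : Vec (Vec Lin 5) 5
basis =
  ((+ 2 t+ + 1)   ∷ (+ 2 t+ + 1)     ∷ (+ 2 t+ + 2)     ∷ (+ 2 t+ + 2)     ∷ (+ 2 t+ + 1)   ∷ []) ∷
  ((+ 0 t+ + 1)   ∷ (- + 4 t+ - + 2) ∷ (+ 0 t+ - + 1)   ∷ (+ 0 t+ + 0)     ∷ (+ 0 t+ + 0)   ∷ []) ∷
  ((+ 0 t+ + 0)   ∷ (+ 0 t+ + 1)     ∷ (- + 4 t+ - + 3) ∷ (+ 0 t+ + 1)     ∷ (+ 0 t+ - + 1) ∷ []) ∷
  ((+ 0 t+ + 1)   ∷ (+ 0 t+ + 0)     ∷ (+ 0 t+ - + 1)   ∷ (- + 4 t+ - + 3) ∷ (+ 0 t+ + 1)   ∷ []) ∷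
  ((+ 0 t+ + 1)   ∷ (+ 0 t+ + 0)     ∷ (+ 0 t+ - + 1)   ∷ (+ 0 t+ + 1)     ∷ (+ 4 t+ + 3)   ∷ []) ∷ []

flip : Sign → ℤ → ℤ
flip pos i = i
flip neg i = - i

flipᶠ : Sign → Lin → Lin
flipᶠ s (p t+ q) = flip s p t+ flip s q

-- Rewrites a form in a as a form in a − 1.
shift : Lin → Lin
shift (p t+ q) = p t+ (p + q)

x₁ x₂ x₃ x₄ x₅ : ℕ → ℕ → Tree 5 → Tree 5 → Tree 5
x₁ = split zero
x₂ = split (suc zero)
x₃ = split (suc (suc zero))
x₄ = split (suc (suc (suc zero)))
x₅ = split (suc (suc (suc (suc zero))))

-- Coordinates with respect to basis of the lattice vectors used at the leaves of the trees.
coefficients : List (Vec ℤ 5)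
coefficients =
  -- The basis has a vector near ±(4k/5)e for every unit vector e but the first; this combination,
  -- (4a + 3, 1, 0, 1, -1), supplies the missing direction.
  (+ 2 ∷ + 1 ∷ + 1 ∷ + 1 ∷ - + 1 ∷ []) ∷
  (+ 0 ∷ + 0 ∷ + 0 ∷ + 0 ∷ + 1 ∷ []) ∷
  (+ 0 ∷ + 0 ∷ + 0 ∷ + 1 ∷ + 0 ∷ []) ∷
  (+ 0 ∷ + 0 ∷ - + 1 ∷ + 0 ∷ + 0 ∷ []) ∷
  (+ 0 ∷ + 1 ∷ + 0 ∷ + 0 ∷ + 0 ∷ []) ∷
  (+ 0 ∷ + 0 ∷ + 1 ∷ + 0 ∷ + 0 ∷ []) ∷
  (+ 2 ∷ + 1 ∷ + 0 ∷ + 1 ∷ - + 1 ∷ []) ∷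
  (+ 0 ∷ + 0 ∷ + 0 ∷ - + 1 ∷ + 0 ∷ []) ∷
  (+ 2 ∷ + 1 ∷ + 1 ∷ + 1 ∷ - + 2 ∷ []) ∷
  (+ 1 ∷ + 1 ∷ + 0 ∷ + 1 ∷ + 0 ∷ []) ∷
  (+ 0 ∷ + 0 ∷ + 0 ∷ + 0 ∷ - + 1 ∷ []) ∷
  (+ 2 ∷ + 1 ∷ + 1 ∷ + 2 ∷ - + 1 ∷ []) ∷
  (+ 1 ∷ + 0 ∷ + 0 ∷ + 1 ∷ + 0 ∷ []) ∷
  (+ 1 ∷ + 0 ∷ + 1 ∷ + 1 ∷ + 0 ∷ []) ∷
  (+ 1 ∷ + 1 ∷ + 1 ∷ + 1 ∷ + 0 ∷ []) ∷
  (+ 1 ∷ + 1 ∷ + 0 ∷ + 1 ∷ - + 1 ∷ []) ∷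
  (+ 1 ∷ + 1 ∷ + 1 ∷ + 1 ∷ - + 1 ∷ []) ∷
  (+ 1 ∷ + 1 ∷ + 0 ∷ + 0 ∷ + 0 ∷ []) ∷
  (+ 1 ∷ + 1 ∷ + 1 ∷ + 0 ∷ + 0 ∷ []) ∷
  (+ 0 ∷ + 0 ∷ - + 1 ∷ + 0 ∷ + 1 ∷ []) ∷
  (+ 1 ∷ + 0 ∷ + 1 ∷ + 1 ∷ - + 1 ∷ []) ∷
  (+ 0 ∷ + 0 ∷ + 1 ∷ + 1 ∷ + 0 ∷ []) ∷
  (+ 0 ∷ - + 1 ∷ + 0 ∷ + 0 ∷ + 0 ∷ []) ∷
  (+ 0 ∷ + 1 ∷ + 0 ∷ - + 1 ∷ + 0 ∷ []) ∷
  (+ 0 ∷ + 1 ∷ + 0 ∷ + 0 ∷ - + 1 ∷ []) ∷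
  (+ 0 ∷ - + 1 ∷ + 0 ∷ + 0 ∷ + 1 ∷ []) ∷
  (+ 1 ∷ + 0 ∷ + 0 ∷ + 1 ∷ - + 1 ∷ []) ∷
  (+ 0 ∷ - + 1 ∷ + 0 ∷ + 1 ∷ + 0 ∷ []) ∷
  (- + 1 ∷ + 0 ∷ - + 1 ∷ + 0 ∷ + 1 ∷ []) ∷
  (+ 1 ∷ + 0 ∷ + 0 ∷ + 0 ∷ - + 1 ∷ []) ∷
  (+ 1 ∷ + 0 ∷ + 1 ∷ + 0 ∷ + 0 ∷ []) ∷
  (+ 1 ∷ + 1 ∷ + 0 ∷ + 0 ∷ - + 1 ∷ []) ∷
  (+ 1 ∷ + 1 ∷ + 1 ∷ + 0 ∷ - + 1 ∷ []) ∷
  (- + 1 ∷ + 0 ∷ + 0 ∷ + 0 ∷ + 1 ∷ []) ∷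
  (- + 1 ∷ + 0 ∷ - + 1 ∷ + 0 ∷ + 0 ∷ []) ∷
  (+ 1 ∷ + 0 ∷ + 0 ∷ + 0 ∷ + 0 ∷ []) ∷
  (- + 1 ∷ + 0 ∷ - + 1 ∷ - + 1 ∷ + 1 ∷ []) ∷
  (- + 1 ∷ - + 1 ∷ - + 1 ∷ + 0 ∷ + 1 ∷ []) ∷
  (- + 1 ∷ + 0 ∷ + 0 ∷ + 0 ∷ + 0 ∷ []) ∷
  (+ 0 ∷ + 0 ∷ + 0 ∷ - + 1 ∷ + 1 ∷ []) ∷
  (+ 2 ∷ + 0 ∷ + 1 ∷ + 1 ∷ - + 1 ∷ []) ∷
  (+ 0 ∷ + 0 ∷ + 0 ∷ + 1 ∷ - + 1 ∷ []) ∷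
  (+ 1 ∷ + 0 ∷ + 1 ∷ + 0 ∷ - + 1 ∷ []) ∷
  (- + 1 ∷ - + 1 ∷ - + 1 ∷ + 0 ∷ + 0 ∷ []) ∷
  (- + 1 ∷ - + 1 ∷ + 0 ∷ + 0 ∷ + 1 ∷ []) ∷
  (+ 0 ∷ + 0 ∷ - + 1 ∷ - + 1 ∷ + 0 ∷ []) ∷
  (- + 1 ∷ + 0 ∷ + 0 ∷ - + 1 ∷ + 1 ∷ []) ∷
  (+ 0 ∷ + 0 ∷ + 1 ∷ + 0 ∷ - + 1 ∷ []) ∷
  (- + 1 ∷ + 0 ∷ - + 1 ∷ - + 1 ∷ + 0 ∷ []) ∷
  (- + 1 ∷ - + 1 ∷ - + 1 ∷ - + 1 ∷ + 1 ∷ []) ∷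
  (+ 2 ∷ + 1 ∷ + 1 ∷ + 0 ∷ - + 1 ∷ []) ∷
  (- + 1 ∷ - + 1 ∷ + 0 ∷ + 0 ∷ + 0 ∷ []) ∷
  (- + 1 ∷ + 0 ∷ + 0 ∷ - + 1 ∷ + 0 ∷ []) ∷
  (+ 0 ∷ + 0 ∷ + 0 ∷ - + 1 ∷ - + 1 ∷ []) ∷
  (+ 0 ∷ + 0 ∷ - + 1 ∷ + 0 ∷ - + 1 ∷ []) ∷
  (+ 0 ∷ + 0 ∷ + 1 ∷ - + 1 ∷ + 0 ∷ []) ∷
  (+ 0 ∷ - + 1 ∷ + 0 ∷ - + 1 ∷ + 0 ∷ []) ∷
  (+ 0 ∷ + 0 ∷ - + 1 ∷ + 1 ∷ + 0 ∷ []) ∷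
  (+ 0 ∷ - + 1 ∷ + 0 ∷ + 0 ∷ - + 1 ∷ []) ∷
  (- + 1 ∷ - + 1 ∷ + 0 ∷ - + 1 ∷ + 1 ∷ []) ∷
  []

-- The signs are those of the last four coordinates, the first being nonnegative; the
-- thresholds are forms in b = a − 1.  The trees were found by a computer search.
tree : Sign → Sign → Sign → Sign → Tree 5
tree pos pos pos pos =
  x₃ 2 5 (x₄ 2 5 (x₅ 2 5 (x₁ 2 5 (x₂ 2 4 (x₄ 2 4 (x₂ 2 3 (x₁ 2 3 (x₃ 2 4 (x₅ 2 3 (↻ 35) (x₄ 2 3 (x₁ 0 0 (x₅ 2
  4 (x₂ 2 2 (↻ 49) (x₃ 2 1 (x₄ 0 0 (↻ 12) (↓ 25)) (↓ 12))) (x₃ 2 3 (x₄ 0 0 (x₂ 2 2 (↻ 37) (↓ 25)) (↓ 1)) (↓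
  19))) (x₃ 2 3 (x₄ 0 0 (x₅ 2 4 (↻ 12) (↓ 1)) (↓ 1)) (↓ 19))) (↓ 39))) (x₄ 2 3 (x₅ 0 0 (x₁ 2 2 (↻ 29) (↓ 6))
  (↓ 3)) (↓ 45))) (x₃ 2 3 (x₅ 2 4 (x₅ 2 3 (x₂ 0 0 (x₁ 2 4 (↻ 17) (x₃ 2 2 (x₄ 0 0 (↻ 9) (↓ 0)) (↓ 6))) (x₄ 0 0
  (x₁ 2 4 (↻ 12) (↓ 0)) (↓ 0))) (x₃ 2 0 (x₄ 0 0 (x₁ 2 4 (↻ 12) (x₂ 0 0 (↻ 9) (↓ 0))) (↓ 1)) (↓ 12))) (↓ 1)) (↓
  6))) (x₃ 0 0 (x₅ 2 3 (x₁ 2 4 (x₄ 0 0 (↻ 13) (x₅ 2 2 (x₁ 2 3 (↻ 30) (↓ 40)) (↓ 25))) (↓ 40)) (↓ 25)) (↓ 22)))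
  (x₃ 0 0 (x₅ 2 2 (x₁ 2 3 (↻ 30) (x₁ 2 4 (x₂ 0 0 (↻ 18) (↓ 50)) (↓ 50))) (↓ 39)) (↓ 7))) (↓ 22)) (↓ 0)) (↓ 1))
  (↓ 7)) (↓ 3)
tree pos pos pos neg =
  x₂ 2 4 (x₄ 2 5 (x₁ 2 5 (x₅ 2 5 (x₃ 2 5 (x₅ 2 4 (x₂ 2 3 (x₄ 2 3 (x₁ 2 2 (↻ 29) (x₃ 2 4 (x₁ 2 4 (x₁ 2 3 (x₂ 0
  0 (↻ 31) (x₅ 0 0 (↻ 35) (x₄ 0 0 (x₅ 2 3 (↻ 26) (x₃ 0 0 (↻ 20) (↓ 8))) (↓ 0)))) (x₃ 2 3 (x₄ 0 0 (x₅ 0 0 (↻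
  12) (x₂ 0 0 (x₅ 2 3 (↻ 15) (x₃ 0 1 (↻ 8) (↓ 8))) (↓ 0))) (x₂ 0 0 (x₅ 0 0 (↻ 17) (↓ 0)) (↓ 0))) (↓ 6))) (x₂ 0
  0 (x₄ 0 0 (x₅ 0 1 (↻ 6) (↓ 0)) (↓ 0)) (↓ 0))) (↓ 6))) (x₁ 2 4 (x₃ 2 4 (x₁ 2 2 (x₃ 0 0 (x₄ 2 4 (↻ 42) (x₅ 0 0
  (↻ 30) (↓ 7))) (x₄ 2 4 (x₅ 0 0 (↻ 35) (↓ 7)) (↓ 7))) (x₃ 2 1 (x₃ 0 0 (x₅ 0 0 (x₂ 0 0 (↻ 18) (x₁ 2 3 (↻ 30)
  (↓ 0))) (x₂ 0 0 (x₄ 2 4 (x₁ 2 3 (↻ 32) (↓ 0)) (↓ 7)) (↓ 0))) (x₄ 2 4 (x₅ 0 0 (x₂ 0 0 (↻ 17) (x₁ 2 3 (↻ 35)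
  (↓ 50))) (↓ 7)) (↓ 7))) (↓ 35))) (↓ 45)) (↓ 0))) (x₃ 0 0 (x₁ 2 2 (x₄ 2 4 (↻ 42) (x₅ 0 0 (↻ 30) (↓ 56))) (x₄
  0 0 (x₁ 2 3 (↻ 20) (x₅ 0 1 (↻ 40) (↓ 40))) (x₁ 2 3 (x₅ 0 0 (↻ 30) (↓ 40)) (↓ 40)))) (↓ 22))) (x₄ 2 4 (x₁ 2 3
  (x₃ 0 0 (x₂ 0 0 (↻ 32) (x₁ 2 2 (↻ 42) (↓ 8))) (↓ 10)) (↓ 8)) (↓ 53))) (↓ 3)) (↓ 10)) (↓ 0)) (↓ 7)) (↓ 22)
tree pos pos neg pos =
  x₁ 2 5 (x₄ 2 5 (x₅ 2 5 (x₂ 2 4 (x₃ 2 5 (x₃ 2 3 (x₄ 2 3 (x₅ 2 4 (x₁ 2 4 (x₂ 2 3 (↻ 12) (x₅ 2 3 (x₃ 0 0 (x₄ 2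
  2 (↻ 13) (x₁ 2 1 (x₅ 0 0 (↻ 20) (↓ 27)) (↓ 20))) (↓ 22)) (↓ 25))) (x₂ 0 0 (x₃ 2 2 (↻ 9) (↓ 6)) (↓ 0))) (x₁ 0
  0 (x₂ 2 2 (↻ 37) (↓ 25)) (↓ 1))) (x₁ 2 4 (x₂ 2 3 (x₅ 0 0 (x₄ 2 4 (x₁ 2 3 (↻ 26) (x₂ 0 0 (↻ 15) (↓ 11))) (x₁
  0 0 (x₂ 2 2 (↻ 43) (↓ 27)) (↓ 2))) (x₁ 0 0 (x₄ 2 4 (x₂ 2 2 (↻ 37) (↓ 27)) (↓ 2)) (↓ 2))) (↓ 27)) (↓ 11)))
  (x₁ 2 3 (x₅ 2 4 (x₂ 2 3 (x₄ 2 3 (x₃ 2 4 (x₅ 0 0 (↻ 26) (x₄ 0 0 (x₅ 2 3 (↻ 35) (x₁ 0 0 (x₂ 2 2 (↻ 49) (↓ 49))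
  (↓ 19))) (↓ 3))) (x₁ 2 2 (x₄ 0 0 (x₅ 0 0 (↻ 29) (↓ 3)) (↓ 3)) (↓ 6))) (x₅ 0 0 (x₂ 2 0 (x₃ 2 4 (x₁ 0 0 (↻ 43)
  (x₄ 2 4 (↻ 26) (↓ 57))) (↓ 3)) (↓ 43)) (↓ 3))) (↓ 22)) (↓ 19)) (↓ 6))) (↓ 3)) (↓ 22)) (↓ 1)) (↓ 2)) (↓ 0)
tree pos pos neg neg =
  x₄ 2 5 (x₁ 2 5 (x₅ 2 5 (x₃ 2 5 (x₂ 2 4 (x₂ 2 3 (x₃ 2 4 (x₅ 2 3 (x₄ 2 4 (x₁ 2 3 (↻ 26) (x₃ 2 3 (x₂ 0 0 (x₁ 2
  4 (↻ 15) (x₄ 2 3 (x₅ 0 0 (x₃ 2 2 (↻ 9) (↓ 6)) (↓ 0)) (↓ 11))) (x₄ 2 3 (x₁ 2 4 (x₅ 0 0 (↻ 12) (↓ 0)) (↓ 0))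
  (↓ 11))) (↓ 6))) (x₁ 0 0 (x₅ 2 2 (x₂ 2 2 (↻ 43) (↓ 27)) (↓ 41)) (↓ 2))) (x₄ 2 3 (x₁ 2 4 (x₁ 2 3 (x₃ 0 0 (x₅
  2 4 (↻ 20) (x₄ 0 0 (x₁ 2 2 (↻ 42) (x₂ 0 1 (↻ 8) (↓ 8))) (↓ 10))) (x₄ 0 0 (x₅ 2 4 (x₁ 2 2 (↻ 29) (x₂ 0 0 (↻
  31) (↓ 8))) (↓ 10)) (↓ 10))) (x₅ 2 4 (x₃ 0 0 (x₂ 0 0 (↻ 16) (↓ 8)) (↓ 8)) (↓ 8))) (↓ 8)) (↓ 41))) (x₄ 0 0
  (x₁ 2 2 (x₅ 2 4 (↻ 29) (↓ 54)) (↓ 6)) (↓ 3))) (x₄ 2 3 (x₁ 2 4 (x₃ 0 0 (x₁ 2 3 (x₅ 2 4 (↻ 20) (x₄ 0 0 (x₁ 2 2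
  (↻ 42) (↓ 29)) (↓ 58))) (x₄ 2 0 (x₅ 0 0 (↻ 13) (↓ 40)) (↓ 13))) (↓ 22)) (↓ 40)) (↓ 27))) (↓ 22)) (↓ 3)) (↓
  10)) (↓ 0)) (↓ 2)
tree pos neg pos pos =
  x₅ 2 5 (x₁ 2 5 (x₂ 2 4 (x₄ 2 5 (x₃ 2 5 (x₅ 2 2 (x₃ 2 3 (x₁ 2 3 (↻ 30) (x₁ 2 4 (x₂ 0 0 (↻ 18) (x₄ 0 0 (↻ 13)
  (↓ 0))) (x₂ 0 0 (x₄ 0 0 (↻ 14) (↓ 0)) (↓ 0)))) (x₂ 0 0 (x₄ 0 0 (↻ 14) (x₁ 2 4 (x₃ 2 4 (↻ 18) (↓ 5)) (↓ 0)))
  (x₁ 2 4 (x₄ 0 0 (x₃ 2 4 (↻ 13) (↓ 5)) (↓ 5)) (↓ 0)))) (x₄ 2 4 (x₁ 2 3 (x₃ 2 3 (x₅ 2 3 (x₄ 0 0 (↻ 13) (x₂ 2 3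
  (x₁ 0 0 (↻ 59) (x₃ 0 0 (↻ 35) (↓ 1))) (↓ 25))) (x₂ 2 3 (x₄ 2 3 (x₁ 0 0 (x₃ 0 0 (x₄ 0 2 (↻ 25) (x₅ 2 4 (x₂ 2
  2 (↻ 49) (↓ 25)) (↓ 1))) (x₅ 2 4 (x₄ 0 0 (↻ 44) (↓ 1)) (↓ 1))) (x₅ 2 4 (x₄ 0 0 (x₃ 0 0 (↻ 12) (↓ 1)) (↓ 1))
  (↓ 1))) (↓ 39)) (↓ 25))) (x₅ 2 4 (x₂ 2 1 (x₂ 0 0 (x₅ 2 3 (x₄ 0 0 (↻ 14) (x₁ 0 0 (x₃ 2 4 (↻ 46) (↓ 5)) (↓
  1))) (x₁ 0 0 (x₄ 0 0 (↻ 33) (↓ 1)) (↓ 1))) (x₄ 0 0 (x₃ 2 4 (x₅ 2 3 (↻ 13) (x₁ 0 0 (↻ 44) (↓ 1))) (↓ 5)) (↓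
  5))) (↓ 44)) (↓ 1))) (x₅ 2 4 (x₂ 2 1 (x₃ 2 1 (x₃ 0 0 (x₁ 2 4 (x₄ 0 0 (↻ 12) (x₅ 2 3 (x₂ 0 0 (↻ 17) (↓ 0)) (↓
  1))) (x₂ 0 0 (x₄ 0 0 (↻ 9) (↓ 0)) (↓ 0))) (x₅ 2 3 (x₄ 0 0 (x₁ 2 4 (↻ 13) (x₂ 0 0 (↻ 14) (↓ 0))) (↓ 1)) (↓
  1))) (↓ 13)) (↓ 12)) (↓ 1))) (↓ 39))) (↓ 5)) (↓ 7)) (↓ 22)) (↓ 0)) (↓ 1)
tree pos neg pos neg =
  x₅ 2 5 (x₃ 2 5 (x₂ 2 4 (x₁ 2 5 (x₄ 2 5 (x₄ 2 4 (x₃ 2 2 (x₁ 2 2 (↻ 42) (x₁ 2 3 (x₅ 0 0 (↻ 30) (x₂ 0 0 (↻ 32)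
  (x₅ 2 4 (x₄ 0 0 (↻ 20) (↓ 0)) (↓ 8)))) (x₅ 2 4 (x₄ 0 0 (x₂ 0 0 (x₅ 0 2 (↻ 0) (x₁ 2 4 (↻ 16) (↓ 0))) (x₅ 0 0
  (x₁ 2 4 (↻ 13) (↓ 0)) (↓ 0))) (x₅ 0 0 (x₂ 0 0 (x₁ 2 4 (↻ 18) (↓ 0)) (↓ 0)) (↓ 0))) (↓ 8)))) (x₁ 2 2 (x₃ 2 4
  (x₃ 2 3 (x₅ 0 0 (↻ 30) (x₂ 0 0 (↻ 32) (x₅ 2 4 (x₄ 0 0 (↻ 20) (↓ 5)) (↓ 47)))) (x₅ 2 4 (x₅ 0 0 (x₂ 0 0 (↻ 18)
  (x₄ 0 0 (↻ 13) (↓ 5))) (x₂ 0 0 (x₄ 0 0 (↻ 16) (↓ 5)) (↓ 5))) (↓ 47))) (x₅ 0 0 (x₂ 0 0 (x₄ 0 2 (↻ 5) (↓ 5))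
  (↓ 5)) (↓ 5))) (x₅ 2 2 (x₂ 0 0 (x₄ 0 0 (x₅ 0 0 (↻ 14) (x₃ 2 4 (x₁ 2 4 (↻ 16) (↓ 0)) (↓ 5))) (x₃ 2 4 (x₁ 2 4
  (x₅ 0 0 (↻ 18) (x₃ 2 3 (x₁ 2 3 (↻ 32) (↓ 0)) (↓ 5))) (↓ 0)) (↓ 5))) (x₃ 2 4 (x₁ 2 4 (x₄ 0 0 (x₅ 0 0 (↻ 13)
  (x₃ 2 3 (x₁ 2 3 (↻ 20) (↓ 0)) (↓ 5))) (x₅ 0 0 (x₃ 2 3 (x₁ 2 3 (↻ 30) (↓ 0)) (↓ 5)) (↓ 5))) (↓ 0)) (↓ 5))) (↓
  20)))) (x₅ 0 0 (x₃ 2 4 (x₁ 2 4 (x₂ 0 0 (↻ 18) (x₃ 2 3 (x₁ 2 3 (↻ 30) (↓ 50)) (↓ 55))) (↓ 50)) (↓ 55)) (↓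
  7))) (↓ 7)) (↓ 0)) (↓ 22)) (↓ 5)) (↓ 10)
tree pos neg neg pos =
  x₂ 2 4 (x₄ 2 5 (x₁ 2 5 (x₅ 2 5 (x₃ 2 5 (x₁ 2 4 (x₃ 2 4 (x₅ 2 3 (x₄ 2 2 (↻ 13) (x₂ 2 3 (x₄ 2 3 (x₁ 0 0 (↻ 44)
  (x₃ 0 0 (↻ 12) (x₅ 0 0 (x₂ 0 0 (↻ 16) (x₁ 2 3 (x₃ 2 3 (↻ 20) (↓ 21)) (↓ 11))) (↓ 2)))) (x₃ 0 0 (x₁ 0 0 (x₅ 0
  2 (↻ 27) (x₂ 2 2 (x₄ 2 4 (↻ 37) (↓ 2)) (↓ 27))) (x₄ 2 4 (x₅ 0 0 (x₂ 0 1 (↻ 11) (x₁ 2 3 (↻ 26) (↓ 11))) (↓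
  2)) (↓ 2))) (x₄ 2 4 (x₁ 0 0 (x₅ 0 0 (x₂ 0 1 (↻ 21) (x₃ 2 3 (↻ 51) (↓ 21))) (↓ 2)) (↓ 2)) (↓ 2)))) (x₄ 2 3
  (x₁ 2 1 (x₅ 0 0 (x₃ 2 3 (↻ 20) (↓ 51)) (↓ 27)) (↓ 20)) (↓ 27)))) (x₂ 2 3 (x₄ 2 4 (x₄ 2 2 (x₁ 0 0 (x₅ 2 4 (↻
  44) (x₂ 2 2 (x₃ 0 0 (↻ 37) (↓ 1)) (↓ 25))) (x₅ 2 4 (x₃ 0 0 (↻ 12) (↓ 1)) (↓ 1))) (x₂ 2 1 (x₃ 0 0 (x₁ 0 0 (↻
  37) (x₄ 2 3 (x₅ 2 4 (↻ 12) (↓ 1)) (↓ 2))) (x₄ 2 3 (x₁ 0 0 (x₅ 2 4 (↻ 44) (↓ 1)) (↓ 1)) (↓ 2))) (↓ 37))) (↓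
  2)) (↓ 25))) (x₂ 0 0 (x₄ 2 3 (x₅ 2 4 (x₁ 0 0 (↻ 33) (x₄ 2 2 (x₅ 2 3 (↻ 14) (↓ 1)) (↓ 21))) (↓ 1)) (↓ 21)) (↓
  5))) (x₂ 0 0 (x₄ 2 3 (x₅ 2 4 (x₃ 0 0 (↻ 9) (x₄ 2 2 (x₅ 2 3 (↻ 14) (↓ 1)) (↓ 11))) (↓ 1)) (↓ 11)) (↓ 0))) (↓
  5)) (↓ 1)) (↓ 0)) (↓ 2)) (↓ 22)
tree pos neg neg neg =
  x₃ 2 5 (x₁ 2 5 (x₂ 2 4 (x₅ 2 5 (x₄ 2 5 (x₄ 2 3 (x₅ 2 4 (x₁ 2 3 (x₃ 2 3 (↻ 20) (x₂ 0 0 (x₃ 2 4 (↻ 16) (x₅ 0 0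
  (x₁ 0 1 (↻ 21) (x₄ 2 2 (↻ 14) (↓ 21))) (↓ 5))) (x₃ 2 4 (x₅ 0 0 (x₄ 2 2 (↻ 13) (x₁ 0 0 (x₂ 2 3 (↻ 44) (↓ 51))
  (↓ 21))) (↓ 5)) (↓ 5)))) (x₃ 2 3 (x₁ 2 4 (x₂ 0 0 (↻ 16) (x₅ 0 0 (x₄ 2 2 (↻ 13) (x₃ 0 0 (x₂ 2 3 (↻ 12) (↓
  26)) (↓ 11))) (↓ 0))) (x₂ 0 0 (x₅ 0 0 (x₃ 0 1 (↻ 11) (x₄ 2 2 (↻ 14) (↓ 11))) (↓ 0)) (↓ 0))) (x₄ 2 0 (x₂ 0 0
  (x₅ 0 0 (↻ 14) (x₃ 2 4 (x₁ 2 4 (↻ 16) (↓ 0)) (↓ 5))) (x₃ 2 4 (x₁ 2 4 (x₅ 0 0 (↻ 13) (↓ 5)) (↓ 0)) (↓ 5))) (↓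
  13)))) (x₃ 2 3 (x₁ 2 3 (x₄ 0 0 (x₂ 0 0 (↻ 32) (x₃ 2 2 (x₁ 2 2 (↻ 42) (↓ 8)) (↓ 47))) (↓ 10)) (↓ 8)) (↓ 47)))
  (x₃ 2 4 (x₁ 2 4 (x₂ 2 3 (x₅ 2 3 (x₃ 2 3 (x₁ 2 3 (x₁ 0 0 (x₄ 2 4 (↻ 51) (x₃ 0 0 (x₂ 2 2 (x₅ 2 2 (↻ 43) (↓
  41)) (↓ 27)) (↓ 2))) (x₃ 0 0 (x₄ 2 4 (↻ 26) (↓ 2)) (↓ 2))) (x₃ 0 0 (x₂ 0 0 (x₄ 2 4 (↻ 15) (↓ 2)) (↓ 11)) (↓
  2))) (x₁ 0 0 (x₂ 0 0 (x₄ 2 4 (↻ 38) (↓ 2)) (↓ 21)) (↓ 2))) (↓ 41)) (↓ 27)) (↓ 11)) (↓ 21))) (↓ 2)) (↓ 10))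
  (↓ 22)) (↓ 0)) (↓ 5)
tree neg pos pos pos =
  x₂ 2 4 (x₁ 2 5 (x₅ 2 5 (x₃ 2 5 (x₄ 2 5 (x₂ 2 3 (x₁ 2 4 (x₅ 2 3 (x₄ 2 4 (x₃ 2 3 (↻ 17) (x₁ 2 3 (x₃ 2 4 (x₂ 0
  0 (↻ 35) (x₅ 0 0 (x₄ 2 3 (↻ 31) (↓ 45)) (↓ 3))) (x₂ 0 0 (x₁ 2 2 (x₅ 0 0 (x₄ 2 3 (↻ 29) (↓ 45)) (↓ 3)) (↓ 6))
  (↓ 3))) (↓ 6))) (x₂ 2 2 (x₅ 2 2 (x₃ 0 0 (↻ 18) (↓ 7)) (↓ 39)) (↓ 23))) (x₃ 2 4 (x₄ 2 3 (x₃ 2 3 (x₁ 0 0 (x₅ 2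
  4 (↻ 36) (x₄ 0 0 (x₂ 0 1 (↻ 19) (x₃ 2 2 (↻ 28) (↓ 19))) (↓ 1))) (x₅ 2 4 (x₄ 0 0 (x₂ 0 0 (↻ 12) (x₃ 2 2 (↻ 9)
  (↓ 19))) (↓ 1)) (↓ 1))) (x₂ 0 0 (x₁ 0 0 (x₅ 2 4 (↻ 49) (↓ 19)) (↓ 19)) (↓ 3))) (↓ 39)) (↓ 3))) (x₅ 2 4 (x₃ 2
  2 (x₄ 0 0 (↻ 9) (↓ 0)) (↓ 6)) (↓ 1))) (x₁ 0 0 (x₃ 2 4 (x₄ 2 3 (x₃ 2 3 (x₅ 2 4 (↻ 36) (x₃ 2 0 (x₄ 0 0 (↻ 28)
  (↓ 1)) (↓ 36))) (x₅ 0 0 (x₄ 2 2 (↻ 48) (↓ 48)) (↓ 3))) (↓ 23)) (↓ 3)) (↓ 4))) (↓ 7)) (↓ 3)) (↓ 1)) (↓ 0)) (↓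
  4)
tree neg pos pos neg =
  x₂ 2 4 (x₄ 2 5 (x₁ 2 5 (x₅ 2 5 (x₃ 2 5 (x₅ 2 4 (x₃ 2 4 (x₂ 2 3 (x₁ 2 3 (x₄ 2 3 (↻ 31) (x₅ 0 0 (x₄ 2 4 (x₂ 0
  0 (↻ 35) (x₃ 2 3 (↻ 17) (↓ 45))) (x₂ 2 2 (x₃ 0 0 (↻ 18) (↓ 7)) (↓ 23))) (x₂ 2 2 (x₄ 2 4 (x₃ 0 0 (↻ 32) (↓
  7)) (↓ 7)) (↓ 23)))) (x₃ 2 3 (x₄ 2 3 (x₁ 2 4 (x₅ 0 0 (↻ 17) (x₄ 0 0 (x₅ 2 3 (↻ 15) (x₂ 2 0 (x₃ 0 0 (↻ 16) (↓
  8)) (↓ 16))) (↓ 0))) (x₄ 0 0 (x₅ 0 0 (x₃ 2 2 (↻ 9) (↓ 6)) (↓ 0)) (↓ 0))) (x₂ 2 0 (x₁ 2 4 (x₅ 0 0 (x₄ 2 4 (↻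
  17) (x₃ 0 0 (↻ 18) (↓ 7))) (↓ 0)) (↓ 0)) (↓ 17))) (↓ 6))) (x₄ 2 3 (x₁ 0 0 (x₅ 2 3 (x₄ 2 2 (↻ 48) (x₅ 0 0 (x₃
  2 3 (↻ 36) (↓ 48)) (↓ 23))) (↓ 24)) (↓ 4)) (↓ 23))) (x₂ 0 0 (x₄ 2 3 (x₁ 2 2 (↻ 29) (↓ 6)) (↓ 45)) (↓ 3)))
  (x₂ 2 2 (x₄ 2 4 (x₁ 2 3 (x₃ 0 0 (↻ 32) (↓ 10)) (↓ 8)) (↓ 53)) (↓ 24))) (↓ 3)) (↓ 10)) (↓ 0)) (↓ 7)) (↓ 4)
tree neg pos neg pos =
  x₃ 2 5 (x₄ 2 5 (x₅ 2 5 (x₂ 2 4 (x₁ 2 5 (x₅ 2 4 (x₂ 2 3 (x₃ 2 2 (x₄ 2 3 (↻ 9) (x₁ 2 4 (x₅ 0 0 (x₄ 2 4 (↻ 15)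
  (x₁ 0 0 (↻ 34) (↓ 2))) (x₄ 2 4 (x₁ 0 0 (↻ 28) (↓ 2)) (↓ 2))) (↓ 11))) (x₁ 2 4 (x₄ 2 3 (x₃ 2 4 (x₃ 2 3 (x₅ 0
  0 (↻ 15) (x₂ 0 0 (↻ 12) (x₄ 0 0 (x₅ 2 3 (↻ 17) (x₁ 0 0 (↻ 36) (↓ 19))) (↓ 3)))) (x₁ 2 3 (x₂ 0 0 (x₅ 0 0 (↻
  26) (x₄ 0 0 (x₅ 2 3 (↻ 35) (x₁ 0 1 (↻ 19) (↓ 19))) (↓ 3))) (x₄ 0 0 (x₅ 0 0 (↻ 31) (↓ 3)) (↓ 3))) (↓ 6))) (x₄
  0 0 (x₅ 0 0 (x₂ 0 1 (↻ 6) (↓ 3)) (↓ 3)) (↓ 3))) (x₃ 2 4 (x₁ 2 1 (x₁ 0 0 (x₂ 0 0 (x₅ 0 0 (↻ 43) (x₃ 2 3 (x₄ 2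
  4 (↻ 37) (↓ 2)) (↓ 3))) (x₃ 2 3 (x₅ 0 0 (↻ 34) (↓ 3)) (↓ 3))) (x₄ 2 4 (x₅ 0 0 (x₃ 2 3 (↻ 15) (x₂ 0 0 (↻ 26)
  (↓ 3))) (↓ 2)) (↓ 2))) (↓ 26)) (↓ 3))) (↓ 6))) (x₁ 0 0 (x₃ 2 2 (x₄ 2 4 (↻ 28) (x₅ 0 0 (↻ 34) (↓ 2))) (x₃ 2 3
  (x₄ 0 0 (↻ 36) (x₅ 0 0 (↻ 34) (↓ 3))) (x₄ 0 0 (x₅ 0 1 (↻ 3) (↓ 3)) (↓ 3)))) (↓ 4))) (x₃ 2 3 (x₄ 2 4 (x₁ 0 0
  (x₃ 2 2 (↻ 28) (x₂ 0 0 (↻ 37) (↓ 19))) (↓ 1)) (↓ 2)) (↓ 19))) (↓ 0)) (↓ 4)) (↓ 1)) (↓ 2)) (↓ 3)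
tree neg pos neg neg =
  x₅ 2 5 (x₂ 2 4 (x₃ 2 5 (x₁ 2 5 (x₄ 2 5 (x₄ 2 4 (x₂ 2 3 (x₁ 2 4 (x₃ 2 3 (x₅ 2 3 (↻ 15) (x₄ 2 3 (x₄ 0 0 (x₅ 2
  4 (x₁ 2 3 (↻ 31) (x₂ 2 0 (x₃ 0 0 (↻ 16) (↓ 8)) (↓ 16))) (x₂ 2 2 (x₃ 0 0 (x₁ 2 3 (↻ 32) (↓ 8)) (↓ 10)) (↓
  24))) (x₅ 2 4 (x₂ 2 2 (x₃ 0 0 (↻ 16) (↓ 10)) (↓ 24)) (↓ 10))) (↓ 41))) (x₅ 2 4 (x₁ 2 3 (x₅ 2 3 (x₃ 2 4 (x₂ 0
  0 (↻ 26) (x₄ 0 0 (↻ 31) (↓ 3))) (x₂ 0 0 (x₁ 2 2 (x₄ 0 0 (↻ 29) (↓ 3)) (↓ 6)) (↓ 3))) (x₁ 2 0 (x₄ 0 0 (x₂ 0 0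
  (↻ 29) (x₃ 2 4 (↻ 31) (↓ 54))) (↓ 10)) (↓ 29))) (↓ 6)) (↓ 10))) (x₅ 0 0 (x₃ 2 2 (x₄ 2 3 (↻ 9) (↓ 11)) (↓ 6))
  (↓ 0))) (x₅ 2 3 (x₃ 2 4 (x₁ 0 0 (x₄ 0 0 (↻ 48) (x₅ 2 2 (x₃ 2 3 (↻ 34) (↓ 3)) (↓ 24))) (↓ 4)) (↓ 3)) (↓ 24)))
  (x₅ 2 2 (x₃ 2 4 (x₁ 0 0 (x₂ 0 0 (↻ 43) (x₃ 2 3 (↻ 34) (↓ 3))) (↓ 2)) (↓ 3)) (↓ 41))) (↓ 2)) (↓ 0)) (↓ 3)) (↓
  4)) (↓ 10)
tree neg neg pos pos =
  x₂ 2 4 (x₃ 2 5 (x₄ 2 5 (x₅ 2 5 (x₁ 2 5 (x₃ 2 4 (x₁ 2 4 (x₅ 2 2 (x₂ 2 2 (↻ 18) (x₄ 2 4 (x₂ 2 3 (x₃ 0 0 (↻ 17)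
  (x₁ 0 0 (↻ 46) (↓ 4))) (x₃ 0 0 (x₄ 2 3 (x₁ 0 0 (↻ 36) (↓ 4)) (↓ 23)) (↓ 4))) (↓ 23))) (x₄ 2 4 (x₂ 2 2 (x₅ 2
  3 (x₃ 0 0 (↻ 17) (x₄ 0 0 (↻ 14) (x₁ 0 0 (↻ 46) (↓ 1)))) (x₄ 2 3 (x₁ 0 0 (x₃ 0 0 (x₄ 0 2 (↻ 1) (x₅ 2 4 (↻ 36)
  (↓ 1))) (x₄ 0 0 (x₅ 2 4 (↻ 33) (↓ 1)) (↓ 1))) (x₃ 0 0 (x₄ 0 0 (x₅ 2 4 (↻ 9) (↓ 1)) (↓ 1)) (↓ 1))) (↓ 39)))
  (x₄ 2 2 (x₁ 0 0 (x₅ 2 4 (x₃ 0 0 (↻ 36) (x₂ 2 3 (x₄ 0 0 (↻ 33) (x₅ 2 3 (↻ 46) (↓ 1))) (↓ 4))) (x₃ 0 0 (x₄ 0 0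
  (↻ 28) (↓ 1)) (↓ 1))) (x₂ 2 3 (x₃ 0 0 (x₅ 2 3 (↻ 17) (x₄ 0 0 (x₅ 2 4 (↻ 9) (↓ 1)) (↓ 1))) (↓ 4)) (↓ 4))) (↓
  36))) (↓ 39))) (x₂ 2 3 (x₄ 0 0 (x₅ 2 4 (x₃ 0 0 (↻ 9) (x₂ 2 2 (x₅ 2 3 (↻ 14) (↓ 1)) (↓ 4))) (↓ 1)) (↓ 0)) (↓
  4))) (x₂ 2 3 (x₄ 0 0 (x₅ 2 4 (x₁ 0 0 (↻ 33) (x₂ 2 2 (x₅ 2 3 (↻ 14) (↓ 1)) (↓ 4))) (↓ 1)) (↓ 5)) (↓ 4))) (↓
  0)) (↓ 1)) (↓ 7)) (↓ 5)) (↓ 4)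
tree neg neg pos neg =
  x₅ 2 5 (x₄ 2 5 (x₃ 2 5 (x₁ 2 5 (x₂ 2 4 (x₂ 2 2 (x₃ 2 3 (x₁ 2 3 (x₅ 0 0 (↻ 18) (x₄ 2 4 (↻ 32) (↓ 7))) (x₅ 2 4
  (x₁ 2 4 (x₅ 0 0 (↻ 18) (x₄ 0 0 (↻ 16) (↓ 0))) (x₅ 0 0 (x₄ 0 0 (↻ 14) (↓ 0)) (↓ 0))) (↓ 8))) (x₅ 2 4 (x₄ 0 0
  (x₅ 0 0 (↻ 14) (x₃ 2 4 (x₁ 2 4 (↻ 16) (↓ 0)) (↓ 5))) (x₅ 0 0 (x₃ 2 4 (x₁ 2 4 (↻ 18) (↓ 0)) (↓ 5)) (↓ 5))) (↓
  47))) (x₅ 2 4 (x₄ 2 4 (x₃ 2 3 (x₁ 2 3 (x₃ 0 0 (x₂ 2 3 (x₅ 0 0 (↻ 17) (x₄ 2 3 (↻ 31) (↓ 23))) (x₅ 2 3 (x₁ 0 0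
  (x₅ 0 2 (↻ 23) (x₄ 2 2 (↻ 48) (↓ 23))) (↓ 4)) (↓ 24))) (x₁ 0 0 (x₂ 2 3 (x₅ 0 0 (↻ 46) (x₄ 2 3 (↻ 52) (↓
  23))) (↓ 4)) (↓ 4))) (x₅ 2 1 (x₃ 0 0 (x₂ 2 3 (x₁ 2 4 (x₅ 0 0 (↻ 17) (x₄ 0 0 (↻ 15) (↓ 0))) (x₅ 0 0 (x₄ 0 1
  (↻ 0) (↓ 0)) (↓ 0))) (↓ 4)) (↓ 4)) (↓ 15))) (x₅ 2 1 (x₁ 0 0 (x₂ 2 3 (x₅ 0 0 (x₄ 0 1 (↻ 5) (x₃ 2 4 (↻ 46) (↓
  5))) (x₄ 0 0 (x₃ 2 4 (↻ 38) (↓ 5)) (↓ 5))) (↓ 4)) (↓ 4)) (↓ 38))) (↓ 23)) (↓ 24))) (↓ 4)) (↓ 0)) (↓ 5)) (↓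
  7)) (↓ 10)
tree neg neg neg pos =
  x₄ 2 5 (x₃ 2 5 (x₅ 2 5 (x₂ 2 4 (x₁ 2 5 (x₄ 2 2 (x₅ 2 3 (x₂ 2 2 (↻ 14) (x₁ 0 0 (x₃ 0 0 (↻ 28) (x₂ 2 3 (↻ 33)
  (↓ 4))) (x₃ 0 0 (x₂ 2 3 (↻ 9) (↓ 4)) (↓ 4)))) (x₃ 0 0 (x₁ 0 0 (↻ 28) (x₅ 2 4 (x₂ 2 3 (↻ 9) (↓ 4)) (↓ 1)))
  (x₅ 2 4 (x₂ 2 3 (x₁ 0 0 (↻ 33) (↓ 1)) (↓ 4)) (↓ 1)))) (x₅ 2 3 (x₂ 2 2 (x₄ 2 3 (x₃ 0 0 (↻ 9) (x₁ 0 0 (↻ 33)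
  (x₃ 2 4 (x₅ 0 0 (x₁ 2 4 (↻ 16) (↓ 11)) (↓ 2)) (↓ 21)))) (x₃ 2 4 (x₁ 2 4 (x₃ 0 0 (x₄ 2 4 (x₅ 0 0 (↻ 15) (x₁ 0
  0 (↻ 28) (↓ 2))) (x₅ 0 0 (x₁ 0 2 (↻ 2) (↓ 2)) (↓ 2))) (x₄ 2 4 (x₅ 0 0 (x₁ 0 0 (↻ 38) (↓ 2)) (↓ 2)) (↓ 2)))
  (↓ 11)) (↓ 21))) (x₃ 2 2 (x₁ 2 2 (x₃ 0 0 (x₁ 0 0 (x₄ 2 4 (↻ 28) (x₅ 0 0 (↻ 34) (↓ 2))) (x₄ 2 4 (x₂ 2 3 (x₄ 2
  3 (↻ 9) (x₅ 0 0 (↻ 15) (↓ 2))) (↓ 4)) (↓ 2))) (x₄ 2 4 (x₂ 2 3 (x₁ 0 0 (x₄ 2 3 (↻ 33) (x₅ 0 0 (↻ 38) (↓ 2)))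
  (↓ 4)) (↓ 4)) (↓ 2))) (↓ 15)) (↓ 38))) (x₄ 2 4 (x₂ 2 1 (x₁ 0 0 (x₃ 0 0 (↻ 28) (x₄ 2 3 (x₅ 2 4 (↻ 33) (↓ 1))
  (↓ 2))) (x₄ 2 3 (x₃ 0 0 (x₅ 2 4 (↻ 9) (↓ 1)) (↓ 1)) (↓ 2))) (↓ 28)) (↓ 2)))) (↓ 0)) (↓ 4)) (↓ 1)) (↓ 5)) (↓
  2)
tree neg neg neg neg =
  x₄ 2 5 (x₁ 2 5 (x₃ 2 5 (x₅ 2 5 (x₂ 2 4 (x₅ 2 4 (x₄ 2 3 (x₃ 2 4 (x₁ 2 4 (x₂ 2 2 (↻ 16) (x₁ 0 0 (x₂ 2 3 (x₅ 2
  3 (↻ 38) (x₄ 0 0 (x₃ 2 3 (↻ 52) (↓ 52)) (↓ 24))) (x₃ 0 0 (x₄ 0 2 (↻ 24) (x₅ 2 2 (↻ 34) (↓ 24))) (↓ 4))) (x₃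
  0 0 (x₂ 2 3 (x₅ 2 3 (↻ 15) (x₄ 0 0 (x₁ 2 3 (↻ 31) (↓ 31)) (↓ 24))) (↓ 4)) (↓ 4)))) (x₅ 0 0 (x₂ 2 3 (x₃ 0 0
  (↻ 9) (x₄ 2 2 (x₂ 2 2 (↻ 14) (↓ 4)) (↓ 11))) (↓ 4)) (↓ 0))) (x₅ 0 0 (x₂ 2 3 (x₁ 0 0 (↻ 33) (x₄ 2 2 (x₂ 2 2
  (↻ 14) (↓ 4)) (↓ 21))) (↓ 4)) (↓ 5))) (x₁ 2 4 (x₃ 2 4 (x₅ 2 3 (x₂ 2 2 (x₁ 0 0 (x₄ 2 4 (↻ 38) (x₃ 0 0 (x₅ 2 2
  (↻ 34) (↓ 41)) (↓ 2))) (x₄ 2 4 (x₃ 0 0 (↻ 15) (↓ 2)) (↓ 2))) (x₅ 2 1 (x₃ 0 0 (x₁ 0 0 (↻ 34) (x₄ 2 4 (x₂ 2 3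
  (↻ 15) (↓ 4)) (↓ 2))) (x₄ 2 4 (x₁ 0 0 (x₂ 2 3 (↻ 38) (↓ 4)) (↓ 2)) (↓ 2))) (↓ 34))) (↓ 41)) (↓ 21)) (↓ 11)))
  (x₄ 0 0 (x₁ 2 3 (x₃ 2 3 (x₂ 2 2 (↻ 32) (↓ 24)) (↓ 47)) (↓ 8)) (↓ 10))) (↓ 4)) (↓ 10)) (↓ 5)) (↓ 0)) (↓ 2)

-- The signs carry the orthant to the nonnegative one, where the norm is the linear function Σ y;
-- `shift` makes a ≥ 1 available to coefficientwise comparison.
orthantVector : Vec Sign 5 → Vec ℤ 5 → Vec Lin 5
orthantVector s c = zipWith flipᶠ s (map shift (comb c basis))

-- This is k in terms of b: 5(b + 1) + 3.
open Check {5} (+ 5 t+ + 8)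

treeCheck : Vec Sign 5 → Tree 5 → Bool
-- The default for an index out of range is the zero vector, which lies in Λ and so cannot break
-- soundness. At the root y ≥ 0 is known and no upper bound.
treeCheck s = check (orthantVector s (replicate _ 0ℤ)) (List.map (orthantVector s) coefficients)
  (replicate _ 0ᶠ) (replicate _ nothing)

tree-checked : ∀ s₂ s₃ s₄ s₅ → T (treeCheck (pos ∷ s₂ ∷ s₃ ∷ s₄ ∷ s₅ ∷ []) (tree s₂ s₃ s₄ s₅))
tree-checked pos pos pos pos = _
tree-checked pos pos pos neg = _
tree-checked pos pos neg pos = _
tree-checked pos pos neg neg = _
tree-checked pos neg pos pos = _
tree-checked pos neg pos neg = _
tree-checked pos neg neg pos = _
tree-checked pos neg neg neg = _
tree-checked neg pos pos pos = _
tree-checked neg pos pos neg = _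
tree-checked neg pos neg pos = _
tree-checked neg pos neg neg = _
tree-checked neg neg pos pos = _
tree-checked neg neg pos neg = _
tree-checked neg neg neg pos = _
tree-checked neg neg neg neg = _

-- Polynomial arithmetic decided on coefficients.

-- Coefficient lists, constant term first.
Poly : Set
Poly = List ℤ

infixl 6 _+ᵖ_
infixl 7 _*ᵖ_ _·ᵖ_
infix 4 _≤ᵖ_ _≡ᵖ_ _≡ᵖˢ_

_+ᵖ_ : Poly → Poly → Poly
[]       +ᵖ q        = q
p        +ᵖ []       = p
(c ∷ p)  +ᵖ (d ∷ q)  = (c + d) ∷ (p +ᵖ q)

_·ᵖ_ : ℤ → Poly → Poly
c ·ᵖ p = List.map (_*_ c) p

_*ᵖ_ : Poly → Poly → Poly
[]      *ᵖ q = []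
(c ∷ p) *ᵖ q = c ·ᵖ q +ᵖ (0ℤ ∷ p *ᵖ q)

-- Missing coefficients count as 0. For values at t ≥ 0 the criterion is sufficient, but beyond
-- degree one not necessary.
_≤ᵖ_ : Poly → Poly → Bool
[]      ≤ᵖ []      = true
[]      ≤ᵖ (d ∷ q) = (0ℤ ≤ᵇ d) ∧ ([] ≤ᵖ q)
(c ∷ p) ≤ᵖ []      = (c ≤ᵇ 0ℤ) ∧ (p ≤ᵖ [])
(c ∷ p) ≤ᵖ (d ∷ q) = (c ≤ᵇ d) ∧ (p ≤ᵖ q)

-- Two inequalities in place of equality of lists, so that trailing zeros do not matter.
_≡ᵖ_ : Poly → Poly → Bool
p ≡ᵖ q = (p ≤ᵖ q) ∧ (q ≤ᵖ p)

_≡ᵖˢ_ : ∀ {m} → Vec Poly m → Vec Poly m → Bool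
[]       ≡ᵖˢ []       = true
(p ∷ ps) ≡ᵖˢ (q ∷ qs) = (p ≡ᵖ q) ∧ (ps ≡ᵖˢ qs)

dotᵖ : ∀ {m} → Vec Poly m → Vec Poly m → Poly
dotᵖ []       []       = []
dotᵖ (p ∷ ps) (q ∷ qs) = p *ᵖ q +ᵖ dotᵖ ps qs

combᵖ : ∀ {m n} → Vec Poly m → Vec (Vec Poly n) m → Vec Poly n
combᵖ []       []       = replicate _ []
combᵖ (c ∷ cs) (b ∷ bs) = zipWith _+ᵖ_ (map (_*ᵖ_ c) b) (combᵖ cs bs)

toPoly : Lin → Poly
toPoly (p t+ q) = q ∷ p ∷ []

module PolyEvaluation (t : ℕ) where
  open Evaluation t

  ⟦_⟧ : Poly → ℤ
  ⟦ [] ⟧    = 0ℤ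
  ⟦ c ∷ p ⟧ = c + ⟦ p ⟧ * + t

  ⟦⟧ˢ : ∀ {m} → Vec Poly m → Vec ℤ m
  ⟦⟧ˢ = map ⟦_⟧

  ⟦+⟧ : ∀ p q → ⟦ p +ᵖ q ⟧ ≡ ⟦ p ⟧ + ⟦ q ⟧
  ⟦+⟧ []      q       = sym (+-identityˡ ⟦ q ⟧)
  ⟦+⟧ (c ∷ p) []      = sym (+-identityʳ ⟦ c ∷ p ⟧)
  ⟦+⟧ (c ∷ p) (d ∷ q) = trans (cong (λ e → c + d + e * + t) (⟦+⟧ p q)) (lemma c d ⟦ p ⟧ ⟦ q ⟧ (+ t))
    where
    lemma : ∀ c d p q t → c + d + (p + q) * t ≡ (c + p * t) + (d + q * t)
    lemma = solve-∀

  ⟦·⟧ : ∀ c p → ⟦ c ·ᵖ p ⟧ ≡ c * ⟦ p ⟧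
  ⟦·⟧ c []      = sym (*-zeroʳ c)
  ⟦·⟧ c (d ∷ p) = trans (cong (λ e → c * d + e * + t) (⟦·⟧ c p)) (lemma c d ⟦ p ⟧ (+ t))
    where
    lemma : ∀ c d p t → c * d + c * p * t ≡ c * (d + p * t)
    lemma = solve-∀

  ⟦*⟧ : ∀ p q → ⟦ p *ᵖ q ⟧ ≡ ⟦ p ⟧ * ⟦ q ⟧
  ⟦*⟧ []      q = sym (*-zeroˡ ⟦ q ⟧)
  ⟦*⟧ (c ∷ p) q = trans (⟦+⟧ (c ·ᵖ q) (0ℤ ∷ p *ᵖ q))
    (trans (cong₂ (λ e f → e + (0ℤ + f * + t)) (⟦·⟧ c q) (⟦*⟧ p q)) (lemma c ⟦ p ⟧ ⟦ q ⟧ (+ t)))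
    where
    lemma : ∀ c p q t → c * q + (0ℤ + p * q * t) ≡ (c + p * t) * q
    lemma = solve-∀

  ⟦≤⟧ : ∀ p q → T (p ≤ᵖ q) → ⟦ p ⟧ ≤ ⟦ q ⟧
  ⟦≤⟧ []      []      _  = ≤-refl
  ⟦≤⟧ []      (d ∷ q) ok = let h , r = Equivalence.to (T-∧ {0ℤ ≤ᵇ d}) ok in
    +-mono-≤ {0ℤ} {d} (≤ᵇ⇒≤ h) (≤-trans (≤-reflexive (sym (*-zeroˡ (+ t)))) (*-monoʳ-≤-nonNeg (+ t) (⟦≤⟧ [] q r)))
  ⟦≤⟧ (c ∷ p) []      ok = let h , r = Equivalence.to (T-∧ {c ≤ᵇ 0ℤ}) ok in
    +-mono-≤ {c} {0ℤ} (≤ᵇ⇒≤ h) (≤-trans (*-monoʳ-≤-nonNeg (+ t) (⟦≤⟧ p [] r)) (≤-reflexive (*-zeroˡ (+ t))))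
  ⟦≤⟧ (c ∷ p) (d ∷ q) ok = let h , r = Equivalence.to (T-∧ {c ≤ᵇ d}) ok in
    +-mono-≤ {c} {d} (≤ᵇ⇒≤ h) (*-monoʳ-≤-nonNeg (+ t) (⟦≤⟧ p q r))

  ⟦≡⟧ : ∀ p q → T (p ≡ᵖ q) → ⟦ p ⟧ ≡ ⟦ q ⟧
  ⟦≡⟧ p q ok = let h , r = Equivalence.to (T-∧ {p ≤ᵖ q}) ok in ≤-antisym (⟦≤⟧ p q h) (⟦≤⟧ q p r)

  ⟦≡⟧ˢ : ∀ {m} (p q : Vec Poly m) → T (p ≡ᵖˢ q) → ⟦⟧ˢ p ≡ ⟦⟧ˢ q
  ⟦≡⟧ˢ []       []       _  = refl
  ⟦≡⟧ˢ (p ∷ ps) (q ∷ qs) ok = let h , r = Equivalence.to (T-∧ {p ≡ᵖ q}) ok in cong₂ _∷_ (⟦≡⟧ p q h) (⟦≡⟧ˢ ps qs r)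

  ⟦dot⟧ : ∀ {m} (p q : Vec Poly m) → ⟦ dotᵖ p q ⟧ ≡ dot (⟦⟧ˢ p) (⟦⟧ˢ q)
  ⟦dot⟧ []       []       = refl
  ⟦dot⟧ (p ∷ ps) (q ∷ qs) = trans (⟦+⟧ (p *ᵖ q) (dotᵖ ps qs)) (cong₂ _+_ (⟦*⟧ p q) (⟦dot⟧ ps qs))

  ⟦+⟧ˢ : ∀ {m} (p q : Vec Poly m) → ⟦⟧ˢ (zipWith _+ᵖ_ p q) ≡ ⟦⟧ˢ p +ᵛ ⟦⟧ˢ q
  ⟦+⟧ˢ []       []       = refl
  ⟦+⟧ˢ (p ∷ ps) (q ∷ qs) = cong₂ _∷_ (⟦+⟧ p q) (⟦+⟧ˢ ps qs)

  ⟦*⟧ˢ : ∀ {m} c (p : Vec Poly m) → ⟦⟧ˢ (map (_*ᵖ_ c) p) ≡ ⟦ c ⟧ *ᵛ ⟦⟧ˢ p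
  ⟦*⟧ˢ c []       = refl
  ⟦*⟧ˢ c (p ∷ ps) = cong₂ _∷_ (⟦*⟧ c p) (⟦*⟧ˢ c ps)

  ⟦comb⟧ : ∀ {m n} (cs : Vec Poly m) (bs : Vec (Vec Poly n) m) → ⟦⟧ˢ (combᵖ cs bs) ≡ combℤ (⟦⟧ˢ cs) (map ⟦⟧ˢ bs)
  ⟦comb⟧ {n = n} [] [] = zeros n
    where
    zeros : ∀ n → ⟦⟧ˢ (replicate n []) ≡ replicate n 0ℤ
    zeros zero    = refl
    zeros (suc n) = cong (0ℤ ∷_) (zeros n)
  ⟦comb⟧ (c ∷ cs) (b ∷ bs) = trans (⟦+⟧ˢ (map (_*ᵖ_ c) b) (combᵖ cs bs)) (cong₂ _+ᵛ_ (⟦*⟧ˢ c b) (⟦comb⟧ cs bs))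

  ⟦toPoly⟧ : ∀ f → ⟦ toPoly f ⟧ ≡ ev f
  ⟦toPoly⟧ (p t+ q) = lemma p q (+ t)
    where
    lemma : ∀ p q t → q + (p + 0ℤ * t) * t ≡ p * t + q
    lemma = solve-∀

  ⟦toPoly⟧ˢ : ∀ {m} (f : Vec Lin m) → ⟦⟧ˢ (map toPoly f) ≡ map ev f
  ⟦toPoly⟧ˢ []       = refl
  ⟦toPoly⟧ˢ (f ∷ fs) = cong₂ _∷_ (⟦toPoly⟧ f) (⟦toPoly⟧ˢ fs)

  ev-· : ∀ c f → ev (c ·ᶠ f) ≡ c * ev f
  ev-· c (p t+ q) = lemma c p q (+ t)
    where
    lemma : ∀ c p q t → c * p * t + c * q ≡ c * (p * t + q)
    lemma = solve-∀

  ev-⊕ᵛ : ∀ {m} (f g : Vec Lin m) → map ev (zipWith _⊕_ f g) ≡ map ev f +ᵛ map ev g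
  ev-⊕ᵛ []       []       = refl
  ev-⊕ᵛ (f ∷ fs) (g ∷ gs) = cong₂ _∷_ (ev-⊕ f g) (ev-⊕ᵛ fs gs)

  ev-·ᵛ : ∀ {m} c (f : Vec Lin m) → map ev (map (c ·ᶠ_) f) ≡ c *ᵛ map ev f
  ev-·ᵛ c []       = refl
  ev-·ᵛ c (f ∷ fs) = cong₂ _∷_ (ev-· c f) (ev-·ᵛ c fs)

  ev-comb : ∀ {m n} (cs : Vec ℤ m) (bs : Vec (Vec Lin n) m) → map ev (comb cs bs) ≡ combℤ cs (map (map ev) bs)
  ev-comb {n = n} [] [] = zeros n
    where
    zeros : ∀ n → map ev (replicate n 0ᶠ) ≡ replicate n 0ℤ
    zeros zero    = refl
    zeros (suc n) = cong₂ _∷_ ev-0 (zeros n)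
  ev-comb (c ∷ cs) (b ∷ bs) = trans (ev-⊕ᵛ (map (c ·ᶠ_) b) (comb cs bs)) (cong₂ _+ᵛ_ (ev-·ᵛ c b) (ev-comb cs bs))

-- Order and generators as polynomials in a; membership in Λ.

posᵖ negᵖ : List ℕ → Poly
posᵖ = List.map (λ c → + c)
negᵖ = List.map (λ c → - + c)

-- Obtained by substituting k = 5a + 3 and dividing out 3125. The positive constant term makes the
-- Horner value a successor by computation, so instance search finds `NonZero`.
orderCoefficients : List ℕ
orderCoefficients = 156 ∷ 916 ∷ 2192 ∷ 2720 ∷ 1792 ∷ 512 ∷ []

generatorCoefficients : Fin 5 → List ℕ
generatorCoefficients zero                         = 1 ∷ []
generatorCoefficients (suc zero)                   = 27 ∷ 168 ∷ 344 ∷ 320 ∷ 128 ∷ []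
generatorCoefficients (suc (suc zero))             = 103 ∷ 472 ∷ 832 ∷ 704 ∷ 256 ∷ []
generatorCoefficients (suc (suc (suc zero)))       = 120 ∷ 526 ∷ 896 ∷ 736 ∷ 256 ∷ []
generatorCoefficients (suc (suc (suc (suc zero)))) = 150 ∷ 698 ∷ 1240 ∷ 1056 ∷ 384 ∷ []

order : Poly
order = posᵖ orderCoefficients

generators : Vec Poly 5
generators = tabulate (posᵖ ∘ generatorCoefficients)

module Lattice (a n : ℕ) .{{_ : NonZero n}} (g : Fin 5 → ℤ)
               (n≡ : + n ≡ PolyEvaluation.⟦_⟧ a order)
               (g≡ : tabulate g ≡ PolyEvaluation.⟦⟧ˢ a generators) where
  open Evaluation a
  open PolyEvaluation a
  open Cayley n g

  Λ : Vec ℤ 5 → Set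
  Λ v = + n ∣ dot (tabulate g) v

  Λ-neg : ∀ v → Λ v → Λ (map -_ v)
  Λ-neg v p = ∣-resp (∣m⇒∣-m p) (dot-neg (tabulate g) v)
    where
    dot-neg : ∀ {m} (g v : Vec ℤ m) → - dot g v ≡ dot g (map -_ v)
    dot-neg []       []       = refl
    dot-neg (g ∷ gs) (v ∷ vs) = trans (neg-distrib-+ (g * v) (dot gs vs))
      (cong₂ _+_ (neg-distribʳ-* g v) (dot-neg gs vs))

  Λ-combℤ : ∀ {m} (cs : Vec ℤ m) (bs : Vec (Vec ℤ 5) m) → All Λ bs → Λ (combℤ cs bs)
  Λ-combℤ []       []       []       = divides 0ℤ (dot-zero (tabulate g))
  Λ-combℤ (c ∷ cs) (b ∷ bs) (p ∷ ps) = ∣-resp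
    (∣m∣n⇒∣m+n (∣n⇒∣m*n c p) (Λ-combℤ cs bs ps))
    (sym (trans (dot-+ʳ (tabulate g) (c *ᵛ b) (combℤ cs bs))
      (cong (_+ dot (tabulate g) (combℤ cs bs)) (dot-*ʳ c (tabulate g) b))))

  -- Membership for all a at once: g · b = q n is an identity of polynomials in a, with q constant.
  Λ-check : ∀ q b → T (dotᵖ generators (map toPoly b) ≡ᵖ q ·ᵖ order) → Λ (map ev b)
  Λ-check q b ok = divides q (trans
    (trans (cong₂ dot g≡ (sym (⟦toPoly⟧ˢ b))) (sym (⟦dot⟧ generators (map toPoly b))))
    (trans (⟦≡⟧ (dotᵖ generators (map toPoly b)) (q ·ᵖ order) ok) (trans (⟦·⟧ q order) (cong (_*_ q) (sym n≡)))))

  Λ-basis : All Λ (map (map ev) basis)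
  Λ-basis = Λ-check (+ 4) (lookup basis zero) _ ∷ Λ-check (- + 1) (lookup basis (suc zero)) _ ∷
    Λ-check (- + 2) (lookup basis (suc (suc zero))) _ ∷ Λ-check (- + 2) (lookup basis (suc (suc (suc zero)))) _ ∷
    Λ-check (+ 3) (lookup basis (suc (suc (suc (suc zero))))) _ ∷ []

  Λ-comb : ∀ cs → Λ (map ev (comb cs basis))
  Λ-comb cs = subst Λ (sym (ev-comb cs basis)) (Λ-combℤ cs (map (map ev) basis) Λ-basis)

-- Upper bound: reduction to an orthant and descent on the norm.

sgn : ℤ → Sign
sgn (+ _)    = pos
sgn -[1+ _ ] = neg

flip-sgn : ∀ i → flip (sgn i) i ≡ + ∣ i ∣
flip-sgn (+ _)    = refl
flip-sgn -[1+ _ ] = refl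

∣flip∣ : ∀ s i → ∣ flip s i ∣ ≡ ∣ i ∣
∣flip∣ pos i = refl
∣flip∣ neg i = ∣-i∣≡∣i∣ i

flip-- : ∀ s i j → flip s (i - j) ≡ flip s i - flip s j
flip-- pos i j = refl
flip-- neg i j = neg-distrib-+ i (- j)

norm-flip : ∀ {m} (s : Vec Sign m) x v → norm (zipWith flip s x ⊖ᵛ zipWith flip s v) ≡ norm (x ⊖ᵛ v)
norm-flip []       []       []       = refl
norm-flip (s ∷ ss) (x ∷ xs) (v ∷ vs) =
  cong₂ ℕ._+_ (trans (cong ∣_∣ (sym (flip-- s x v))) (∣flip∣ s (x - v))) (norm-flip ss xs vs)

sum-flip : ∀ {m} (x : Vec ℤ m) → sum (zipWith flip (map sgn x) x) ≡ + norm x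
sum-flip []       = refl
sum-flip (x ∷ xs) = cong₂ _+_ (flip-sgn x) (sum-flip xs)

norm-neg : ∀ {m} (x v : Vec ℤ m) → norm (map -_ x ⊖ᵛ v) ≡ norm (x ⊖ᵛ map -_ v)
norm-neg []       []       = refl
norm-neg (x ∷ xs) (v ∷ vs) =
  cong₂ ℕ._+_ (trans (sym (∣-i∣≡∣i∣ (- x - v))) (cong ∣_∣ (lemma x v))) (norm-neg xs vs)
  where
  lemma : ∀ x v → - (- x - v) ≡ x - - v
  lemma = solve-∀

norm-map-neg : ∀ {m} (x : Vec ℤ m) → norm (map -_ x) ≡ norm x
norm-map-neg []       = refl
norm-map-neg (x ∷ xs) = cong₂ ℕ._+_ (∣-i∣≡∣i∣ x) (norm-map-neg xs)

module Cover (b n k : ℕ) .{{_ : NonZero n}} (g : Fin 5 → ℤ)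
             (n≡ : + n ≡ PolyEvaluation.⟦_⟧ (suc b) order)
             (g≡ : tabulate g ≡ PolyEvaluation.⟦⟧ˢ (suc b) generators)
             (k≡ : + k ≡ Evaluation.ev b (+ 5 t+ + 8)) where
  open Lattice (suc b) n g n≡ g≡
  open Cayley n g
  open Evaluation b
  open Evaluation (suc b) using () renaming (ev to ev⁺)
  open Sound b

  ev-orthantVector : ∀ {m} (s : Vec Sign m) (f : Vec Lin m) →
                     map ev (zipWith flipᶠ s (map shift f)) ≡ zipWith flip s (map ev⁺ f)
  ev-orthantVector []       []       = refl
  ev-orthantVector (s ∷ ss) (f ∷ fs) = cong₂ _∷_ (head s f) (ev-orthantVector ss fs)
    where
    head⁺ : ∀ p q t → p * t + (p + q) ≡ p * (1ℤ + t) + q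
    head⁺ = solve-∀
    head⁻ : ∀ p q t → - p * t + - (p + q) ≡ - (p * (1ℤ + t) + q)
    head⁻ = solve-∀
    head : ∀ s f → ev (flipᶠ s (shift f)) ≡ flip s (ev⁺ f)
    head pos (p t+ q) = head⁺ p q (+ b)
    head neg (p t+ q) = head⁻ p q (+ b)

  Improvable : Vec ℤ 5 → Set
  Improvable x = ∃ λ v → Λ v × (norm (x ⊖ᵛ v) ℕ.< norm x ⊎ norm (x ⊖ᵛ v) ℕ.≤ k)

  improve⁺ : ∀ x₁ xs → let x = + x₁ ∷ xs in k ℕ.< norm x → Improvable x
  improve⁺ x₁ (x₂ ∷ x₃ ∷ x₄ ∷ x₅ ∷ []) k<x = conclude
      (check-sound (certify (replicate _ 0ℤ)) (ListAll.map⁺ (ListAll.universal certify coefficients)) y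
        -- `sgn (+ x₁)` computes to `pos`, the first sign for which the trees are checked.
        (tree (sgn x₂) (sgn x₃) (sgn x₄) (sgn x₅)) (tree-checked (sgn x₂) (sgn x₃) (sgn x₄) (sgn x₅))
        (subst₂ _<_ k≡ (sym (sum-flip x)) (+<+ k<x))
        (nonneg x) (unbounded y))
    where
    x s y : Vec _ 5
    x = + x₁ ∷ x₂ ∷ x₃ ∷ x₄ ∷ x₅ ∷ []
    s = map sgn x
    y = zipWith flip s x
    InOrthant : Vec Lin 5 → Set
    InOrthant w = ∃ λ v → Λ v × map ev w ≡ zipWith flip s v
    certify : ∀ c → InOrthant (orthantVector s c)
    certify c = map ev⁺ (comb c basis) , Λ-comb c , ev-orthantVector s (comb c basis)
    nonneg : ∀ {m} (x : Vec ℤ m) → Pointwise _≥ˡ_ (replicate m 0ᶠ) (zipWith flip (map sgn x) x)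
    nonneg []       = []
    nonneg (x ∷ xs) = subst₂ _≤_ (sym ev-0) (sym (flip-sgn x)) (+≤+ ℕ.z≤n) ∷ nonneg xs
    unbounded : ∀ {m} (y : Vec ℤ m) → Pointwise _≤ᵘ_ (replicate m nothing) y
    unbounded []       = []
    unbounded (_ ∷ ys) = tt ∷ unbounded ys
    conclude : (∃ λ w → InOrthant w × (Shortens y w ⊎ Reflects y w)) → Improvable x
    conclude (w , (v , Λv , eq) , inj₁ p) = v , Λv , inj₁ (drop‿+<+
      (subst₂ _<_ (cong (λ e → + e) (trans (cong (λ e → norm (y ⊖ᵛ e)) eq) (norm-flip s x v))) (sum-flip x) p))
    conclude (w , (v , Λv , eq) , inj₂ p) = v , Λv , inj₂ (drop‿+≤+
      (subst₂ _≤_ (cong (λ e → + e) (trans (cong (λ e → norm (y ⊖ᵛ e)) eq) (norm-flip s x v))) (sym k≡) p))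

  -- Because Λ = -Λ, a negative first coordinate is handled by passing to -x and negating the
  -- lattice vector found.
  improve : ∀ x → k ℕ.< norm x → Improvable x
  improve (+ x₁ ∷ xs)          k<x = improve⁺ x₁ xs k<x
  improve x@(-[1+ x₁ ] ∷ xs) k<x
    with improve⁺ (suc x₁) (map -_ xs) (subst (k ℕ.<_) (sym (norm-map-neg x)) k<x)
  ... | v , Λv , better = map -_ v , Λ-neg v Λv ,
    subst₂ (λ d e → d ℕ.< e ⊎ d ℕ.≤ k) (norm-neg x v) (norm-map-neg x) better

  descend : ∀ x → Acc ℕ._<_ (norm x) → ∃ λ y → norm y ℕ.≤ k × dot (tabulate g) y ≋ dot (tabulate g) x
  descend x (acc rec) with norm x ℕ.≤? k
  ... | yes x≤k = x , x≤k , ≋-reflexive refl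
  ... | no  x≰k with improve x (ℕ.≰⇒> x≰k)
  ...   | v , Λv , better = go better
    where
    congruent : dot (tabulate g) (x ⊖ᵛ v) ≋ dot (tabulate g) x
    congruent = ≋-intro (∣-resp (∣m⇒∣-m Λv)
      (trans (lemma (dot (tabulate g) x) (dot (tabulate g) v))
        (cong (_- dot (tabulate g) x) (sym (dot-- (tabulate g) x v)))))
      where
      lemma : ∀ x v → - v ≡ x - v - x
      lemma = solve-∀
    go : norm (x ⊖ᵛ v) ℕ.< norm x ⊎ norm (x ⊖ᵛ v) ℕ.≤ k →
         ∃ λ y → norm y ℕ.≤ k × dot (tabulate g) y ≋ dot (tabulate g) x
    go (inj₂ small) = x ⊖ᵛ v , small , congruent
    go (inj₁ less)  = let y , y≤k , p = descend (x ⊖ᵛ v) (rec less) in y , y≤k , ≋-trans p congruent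

  covering-holds : Covering k
  covering-holds z = let y , y≤k , p = descend start (<-wellFounded (norm start)) in
    y , y≤k , ≋-trans p (≋-reflexive start≡z)
    where
    start : Vec ℤ 5
    -- Since g₁ = 1, this vector represents z, however long it is; the descent shortens it.
    start = z ∷ replicate _ 0ℤ
    start≡z : dot (tabulate g) start ≡ z
    start≡z = trans (cong₂ _+_ (cong (λ v → lookup v zero * z) g≡)
      (dot-zero (tabulate (g ∘ suc)))) (lemma z (+ suc b))
      where
      lemma : ∀ z t → (1ℤ + 0ℤ * t) * z + 0ℤ ≡ z
      lemma = solve-∀

-- Lower bound: the inverse basis matrix and the deep hole.

-- A row of n B⁻¹, B being the matrix with columns basis.  Splitting it as
-- leading · g + n · rest shows that B⁻¹ y is integral as soon as n divides g · y.
record DualRow : Set where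
  field
    leading : Poly
    rest    : Vec Poly 5
    bound   : Poly

  row : Vec Poly 5
  row = zipWith _+ᵖ_ (map (_*ᵖ_ leading) generators) (map (_*ᵖ_ order) rest)

open DualRow

-- As g₁ = 1, `leading` is the first entry of the row and `rest` starts with 0; its other entries
-- are the quotients by n of row minus `leading` times g. `bound` dominates the absolute values of
-- all entries.
dual : Vec DualRow 5
dual =
  record
    { leading = posᵖ (82 ∷ 408 ∷ 784 ∷ 704 ∷ 256 ∷ [])
    ; rest    = [] ∷ map negᵖ ((14 ∷ 76 ∷ 112 ∷ 64 ∷ []) ∷ (54 ∷ 200 ∷ 256 ∷ 128 ∷ []) ∷
                               (63 ∷ 220 ∷ 272 ∷ 128 ∷ []) ∷ (79 ∷ 296 ∷ 384 ∷ 192 ∷ []) ∷ [])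
    ; bound   = posᵖ (82 ∷ 408 ∷ 784 ∷ 704 ∷ 256 ∷ [])
    } ∷
  record
    { leading = posᵖ (56 ∷ 260 ∷ 464 ∷ 384 ∷ 128 ∷ [])
    ; rest    = [] ∷ map negᵖ ((10 ∷ 48 ∷ 64 ∷ 32 ∷ []) ∷ (37 ∷ 124 ∷ 144 ∷ 64 ∷ []) ∷
                               (43 ∷ 136 ∷ 152 ∷ 64 ∷ []) ∷ (54 ∷ 184 ∷ 216 ∷ 96 ∷ []) ∷ [])
    ; bound   = posᵖ (56 ∷ 260 ∷ 464 ∷ 384 ∷ 128 ∷ [])
    } ∷
  record
    { leading = posᵖ (30 ∷ 172 ∷ 368 ∷ 352 ∷ 128 ∷ [])
    ; rest    = [] ∷ map negᵖ ((5 ∷ 32 ∷ 56 ∷ 32 ∷ []) ∷ (20 ∷ 88 ∷ 128 ∷ 64 ∷ []) ∷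
                               (23 ∷ 98 ∷ 136 ∷ 64 ∷ []) ∷ (29 ∷ 130 ∷ 192 ∷ 96 ∷ []) ∷ [])
    ; bound   = posᵖ (30 ∷ 172 ∷ 368 ∷ 352 ∷ 128 ∷ [])
    } ∷
  record
    { leading = posᵖ (53 ∷ 256 ∷ 464 ∷ 384 ∷ 128 ∷ [])
    ; rest    = [] ∷ map negᵖ ((9 ∷ 48 ∷ 64 ∷ 32 ∷ []) ∷ (35 ∷ 124 ∷ 144 ∷ 64 ∷ []) ∷
                               (41 ∷ 136 ∷ 152 ∷ 64 ∷ []) ∷ (51 ∷ 184 ∷ 216 ∷ 96 ∷ []) ∷ [])
    ; bound   = posᵖ (53 ∷ 256 ∷ 464 ∷ 384 ∷ 128 ∷ [])
    } ∷
  record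
    { leading = negᵖ (35 ∷ 172 ∷ 336 ∷ 320 ∷ 128 ∷ [])
    ; rest    = [] ∷ map posᵖ ((6 ∷ 32 ∷ 48 ∷ 32 ∷ []) ∷ (23 ∷ 84 ∷ 112 ∷ 64 ∷ []) ∷
                               (27 ∷ 92 ∷ 120 ∷ 64 ∷ []) ∷ (34 ∷ 124 ∷ 168 ∷ 96 ∷ []) ∷ [])
    ; bound   = posᵖ (54 ∷ 258 ∷ 464 ∷ 384 ∷ 128 ∷ [])
    } ∷ []

-- A column of the array `basis`, hence a row of the matrix B.
column : Fin 5 → Vec Poly 5
column r = map (λ b → toPoly (lookup b r)) basis

-- The identity B (n B⁻¹) = n I, row by row, as polynomials in a. It shows that the basis generates
-- Λ and does not merely lie in it.
dual-inverse : ∀ r → T (combᵖ (column r) (map row dual) ≡ᵖˢ map (_·ᵖ order) (unit r))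
dual-inverse zero                         = _
dual-inverse (suc zero)                   = _
dual-inverse (suc (suc zero))             = _
dual-inverse (suc (suc (suc zero)))       = _
dual-inverse (suc (suc (suc (suc zero)))) = _

-- All coordinates of vectors congruent to this one are about a ≈ k/5 or larger in
-- absolute value, because the lattice is close to (2k/5) D with D = {v : v i ≡ v j mod 2}.
centre : Vec Lin 5
centre = (+ 1 t+ + 1) ∷ (+ 1 t+ + 1) ∷ (+ 1 t+ + 1) ∷ (+ 1 t+ + 0) ∷ (+ 1 t+ + 0) ∷ []

entriesBounded : ∀ {m} → Poly → Vec Poly m → Bool
entriesBounded M []       = true
entriesBounded M (p ∷ ps) = (p ≤ᵖ M) ∧ (-1ℤ ·ᵖ p ≤ᵖ M) ∧ entriesBounded M ps

-- This is k - 1, as the vectors to be excluded satisfy ∥x∥ < k.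
radius : Poly
radius = toPoly (+ 5 t+ + 2)

shiftAt : DualRow → Poly
shiftAt d = dotᵖ (row d) (map toPoly centre)

-- With M the bound, R the radius and S the row applied to x₀, the coordinate c satisfies |n c + S|
-- ≤ M R, and the two inequalities force -3 < c < 2. For the first row M R is about 5n/2 and S about
-- n/2, so both are ties at degree five, settled by the lower terms.
rowCheck : DualRow → Bool
rowCheck d = entriesBounded (bound d) (row d)
  ∧ (bound d *ᵖ radius +ᵖ (1ℤ ∷ []) ≤ᵖ + 2 ·ᵖ order +ᵖ shiftAt d)
  ∧ (- + 3 ·ᵖ order +ᵖ shiftAt d +ᵖ (1ℤ ∷ []) ≤ᵖ -1ℤ ·ᵖ (bound d *ᵖ radius))

dual-checked : All (T ∘ rowCheck) dual
dual-checked = _ ∷ _ ∷ _ ∷ _ ∷ _ ∷ []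

-- Only a lower bound for the absolute value when slope and intercept have opposite signs.
absᶠ : Lin → Lin
absᶠ (+ 0 t+ q)        = 0ℤ t+ + ∣ q ∣
absᶠ f@(+[1+ _ ] t+ _) = f
absᶠ f@(-[1+ _ ] t+ _) = -1ℤ ·ᶠ f

allBox : ∀ m → (Vec ℤ m → Bool) → Bool
allBox zero    f = f []
allBox (suc m) f = (allBox m (f ∘ (- + 2 ∷_)) ∧ allBox m (f ∘ (- + 1 ∷_)))
                 ∧ (allBox m (f ∘ (+ 0 ∷_))   ∧ allBox m (f ∘ (+ 1 ∷_)))

InBox : ℤ → Set
InBox c = - + 2 ≤ c × c ≤ + 1

allBox-sound : ∀ {m} f → T (allBox m f) → ∀ (cs : Vec ℤ m) → All InBox cs → T (f cs)
allBox-sound f ok [] [] = ok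
allBox-sound {suc m} f ok (c ∷ cs) (c∈ ∷ cs∈) = allBox-sound (f ∘ (c ∷_)) (pickCase c c∈) cs cs∈
  where
  F : ℤ → Bool
  F c = allBox m (f ∘ (c ∷_))
  oks : T (F (- + 2) ∧ F (- + 1)) × T (F (+ 0) ∧ F (+ 1))
  oks = Equivalence.to T-∧ ok
  pickCase : ∀ c → InBox c → T (F c)
  pickCase (+ 0)          _                   = proj₁ (Equivalence.to (T-∧ {F (+ 0)}) (proj₂ oks))
  pickCase (+ 1)          _                   = proj₂ (Equivalence.to (T-∧ {F (+ 0)}) (proj₂ oks))
  pickCase (+ suc (suc _)) (_ , +≤+ (s≤s ()))
  pickCase -[1+ 0 ]       _                   = proj₂ (Equivalence.to (T-∧ {F (- + 2)}) (proj₁ oks))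
  pickCase -[1+ 1 ]       _                   = proj₁ (Equivalence.to (T-∧ {F (- + 2)}) (proj₁ oks))
  pickCase -[1+ suc (suc _) ] (-≤- (s≤s ()) , _)

far : Vec ℤ 5 → Bool
far cs = (+ 5 t+ + 3) ≤ᶠ Σᶠ (map absᶠ (zipWith _⊕_ centre (comb cs basis)))

far-checked : T (allBox 5 far)
far-checked = _

-- Hölder's inequality for the pair ℓ∞, ℓ₁.
dot-bound : ∀ {m} (M : ℤ) (r x : Vec ℤ m) → All (λ e → + ∣ e ∣ ≤ M) r → + ∣ dot r x ∣ ≤ M * + norm x
dot-bound M []       []       []       = ≤-reflexive (sym (*-zeroʳ M))
dot-bound M (r ∷ rs) (x ∷ xs) (p ∷ ps) = begin
  + ∣ r * x + dot rs xs ∣               ≤⟨ +≤+ (∣i+j∣≤∣i∣+∣j∣ (r * x) (dot rs xs)) ⟩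
  + ∣ r * x ∣ + + ∣ dot rs xs ∣         ≡⟨ cong (λ e → + e + + ∣ dot rs xs ∣) (abs-* r x) ⟩
  + (∣ r ∣ ℕ.* ∣ x ∣) + + ∣ dot rs xs ∣ ≡⟨ cong (_+ + ∣ dot rs xs ∣) (pos-* ∣ r ∣ ∣ x ∣) ⟩
  + ∣ r ∣ * + ∣ x ∣ + + ∣ dot rs xs ∣   ≤⟨ +-mono-≤ (*-monoʳ-≤-nonNeg (+ ∣ x ∣) p) (dot-bound M rs xs ps) ⟩
  M * + ∣ x ∣ + M * + norm xs           ≡⟨ *-distribˡ-+ M (+ ∣ x ∣) (+ norm xs) ⟨
  M * + norm (x ∷ xs)                   ∎
  where open ≤-Reasoning

i≤∣i∣ : ∀ i → i ≤ + ∣ i ∣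
i≤∣i∣ (+ _)    = ≤-refl
i≤∣i∣ -[1+ _ ] = -≤+

-i≤∣i∣ : ∀ i → - i ≤ + ∣ i ∣
-i≤∣i∣ i = subst (λ e → - i ≤ + e) (∣-i∣≡∣i∣ i) (i≤∣i∣ (- i))

lookup-ext : ∀ {m} {A : Set} (u v : Vec A m) → (∀ r → lookup u r ≡ lookup v r) → u ≡ v
lookup-ext u v eq = trans (sym (tabulate∘lookup u)) (trans (tabulate-cong eq) (tabulate∘lookup v))

module DeepHole (a n k : ℕ) .{{_ : ℕ.NonZero n}} (g : Fin 5 → ℤ)
                (n≡ : + n ≡ PolyEvaluation.⟦_⟧ a order)
                (g≡ : tabulate g ≡ PolyEvaluation.⟦⟧ˢ a generators)
                (k≡ : + k ≡ Evaluation.ev a (+ 5 t+ + 3)) where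
  open Evaluation a
  open PolyEvaluation a
  open Cayley n g

  ∣ev∣≥ : ∀ f → ev (absᶠ f) ≤ + ∣ ev f ∣
  ∣ev∣≥ (+ 0 t+ q)        = ≤-reflexive (trans (lemma (+ ∣ q ∣) (+ a)) (cong (λ e → + ∣ e ∣) (sym (lemma q (+ a)))))
    where
    lemma : ∀ q t → 0ℤ * t + q ≡ q
    lemma = solve-∀
  ∣ev∣≥ f@(+[1+ _ ] t+ _) = i≤∣i∣ (ev f)
  ∣ev∣≥ f@(-[1+ _ ] t+ _) = ≤-trans (≤-reflexive (trans (ev-· -1ℤ f) (-1*i≡-i (ev f)))) (-i≤∣i∣ (ev f))

  norm-ev : ∀ {m} (fs : Vec Lin m) → ev (Σᶠ (map absᶠ fs)) ≤ + norm (map ev fs)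
  norm-ev []       = ≤-reflexive ev-0
  norm-ev (f ∷ fs) = ≤-trans (≤-reflexive (ev-⊕ (absᶠ f) (Σᶠ (map absᶠ fs)))) (+-mono-≤ (∣ev∣≥ f) (norm-ev fs))

  entriesBounded-sound : ∀ {m} M (ps : Vec Poly m) → T (entriesBounded M ps) → All (λ e → + ∣ e ∣ ≤ ⟦ M ⟧) (⟦⟧ˢ ps)
  entriesBounded-sound M []       _  = []
  entriesBounded-sound M (p ∷ ps) ok =
    let h , ok′ = Equivalence.to (T-∧ {p ≤ᵖ M}) ok
        h′ , r  = Equivalence.to (T-∧ { -1ℤ ·ᵖ p ≤ᵖ M}) ok′ in
    ∣i∣≤j (⟦≤⟧ p M h) (≤-trans (≤-reflexive (sym (trans (⟦·⟧ -1ℤ p) (-1*i≡-i ⟦ p ⟧)))) (⟦≤⟧ (-1ℤ ·ᵖ p) M h′))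
    ∷ entriesBounded-sound M ps r

  x₀ : Vec ℤ 5
  x₀ = map ev centre

  module Near (x : Vec ℤ 5) (q : ℤ) (q≡ : dot (tabulate g) x - dot (tabulate g) x₀ ≡ q * + n) where

    y : Vec ℤ 5
    y = x ⊖ᵛ x₀

    g·y : dot (⟦⟧ˢ generators) y ≡ q * + n
    g·y = trans (cong (λ v → dot v y) (sym g≡)) (trans (dot-- (tabulate g) x x₀) q≡)

    -- An entry of B⁻¹ y with the division by n already carried out, g · y being q n.
    coordinate : DualRow → ℤ
    coordinate d = ⟦ leading d ⟧ * q + dot (⟦⟧ˢ (rest d)) y

    n*coordinate : ∀ d → + n * coordinate d ≡ dot (⟦⟧ˢ (row d)) y
    n*coordinate d = sym (begin
      dot (⟦⟧ˢ (row d)) y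
        ≡⟨ cong (λ v → dot v y) (trans (⟦+⟧ˢ (map (_*ᵖ_ (leading d)) generators) (map (_*ᵖ_ order) (rest d)))
             (cong₂ _+ᵛ_ (⟦*⟧ˢ (leading d) generators) (⟦*⟧ˢ order (rest d)))) ⟩
      dot (⟦ leading d ⟧ *ᵛ ⟦⟧ˢ generators +ᵛ ⟦ order ⟧ *ᵛ ⟦⟧ˢ (rest d)) y
        ≡⟨ trans (dot-+ˡ (⟦ leading d ⟧ *ᵛ ⟦⟧ˢ generators) (⟦ order ⟧ *ᵛ ⟦⟧ˢ (rest d)) y)
             (cong₂ _+_ (dot-*ˡ ⟦ leading d ⟧ (⟦⟧ˢ generators) y) (dot-*ˡ ⟦ order ⟧ (⟦⟧ˢ (rest d)) y)) ⟩
      ⟦ leading d ⟧ * dot (⟦⟧ˢ generators) y + ⟦ order ⟧ * dot (⟦⟧ˢ (rest d)) y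
        ≡⟨ cong₂ (λ e f → ⟦ leading d ⟧ * e + f * dot (⟦⟧ˢ (rest d)) y) g·y (sym n≡) ⟩
      ⟦ leading d ⟧ * (q * + n) + + n * dot (⟦⟧ˢ (rest d)) y
        ≡⟨ lemma ⟦ leading d ⟧ q (+ n) (dot (⟦⟧ˢ (rest d)) y) ⟩
      + n * coordinate d ∎)
      where
      open ≡-Reasoning
      lemma : ∀ u q n w → u * (q * n) + n * w ≡ n * (u * q + w)
      lemma = solve-∀

    coordinates : Vec ℤ 5
    coordinates = map coordinate dual

    column-ev : ∀ r → ⟦⟧ˢ (column r) ≡ map (λ b → lookup b r) (map (map ev) basis)
    column-ev r = trans (sym (map-∘ ⟦_⟧ (λ b → toPoly (lookup b r)) basis))
      (trans (map-cong (λ b → trans (⟦toPoly⟧ (lookup b r)) (sym (lookup-map r ev b))) basis)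
      (map-∘ (λ b → lookup b r) (map ev) basis))

    unit-ev : ∀ {m} (r : Vec ℤ m) → ⟦⟧ˢ (map (_·ᵖ order) r) ≡ + n *ᵛ r
    unit-ev []      = refl
    unit-ev (c ∷ r) = cong₂ _∷_ (trans (⟦·⟧ c order) (trans (cong (_*_ c) (sym n≡)) (*-comm c (+ n)))) (unit-ev r)

    -- Both sides are compared after multiplication by n, where B (n B⁻¹) y = n y applies; the
    -- factor n is then cancelled.
    expansion : combℤ coordinates (map (map ev) basis) ≡ y
    expansion = lookup-ext _ y λ r → *-cancelˡ-≡ (+ n) _ _ (begin
      + n * lookup (combℤ coordinates (map (map ev) basis)) r
        ≡⟨ cong (_*_ (+ n)) (trans (lookup-combℤ coordinates (map (map ev) basis) r)
             (cong (dot coordinates) (sym (column-ev r)))) ⟩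
      + n * dot coordinates (⟦⟧ˢ (column r))
        ≡⟨ dot-*ˡ (+ n) coordinates (⟦⟧ˢ (column r)) ⟨
      dot (+ n *ᵛ coordinates) (⟦⟧ˢ (column r))
        ≡⟨ cong (λ v → dot v (⟦⟧ˢ (column r))) scaled ⟩
      dot (map (λ A → dot A y) (map ⟦⟧ˢ (map row dual))) (⟦⟧ˢ (column r))
        ≡⟨ trans (dot-comm (map (λ A → dot A y) (map ⟦⟧ˢ (map row dual))) (⟦⟧ˢ (column r)))
             (sym (dot-combℤ (⟦⟧ˢ (column r)) (map ⟦⟧ˢ (map row dual)) y)) ⟩
      dot (combℤ (⟦⟧ˢ (column r)) (map ⟦⟧ˢ (map row dual))) y
        ≡⟨ cong (λ v → dot v y) (trans (sym (⟦comb⟧ (column r) (map row dual)))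
             (trans (⟦≡⟧ˢ (combᵖ (column r) (map row dual)) (map (_·ᵖ order) (unit r)) (dual-inverse r))
             (unit-ev (unit r)))) ⟩
      dot (+ n *ᵛ unit r) y
        ≡⟨ trans (dot-*ˡ (+ n) (unit r) y) (cong (_*_ (+ n)) (dot-unit r y)) ⟩
      + n * lookup y r ∎)
      where
      open ≡-Reasoning
      scaled : + n *ᵛ coordinates ≡ map (λ A → dot A y) (map ⟦⟧ˢ (map row dual))
      scaled = trans (sym (map-∘ (_*_ (+ n)) coordinate dual))
        (trans (map-cong n*coordinate dual)
        (trans (map-∘ (λ A → dot A y) (⟦⟧ˢ ∘ row) dual) (cong (map (λ A → dot A y)) (map-∘ ⟦⟧ˢ row dual))))

    x-expansion : map ev (zipWith _⊕_ centre (comb coordinates basis)) ≡ x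
    x-expansion = trans (ev-⊕ᵛ centre (comb coordinates basis))
      (trans (cong (_+ᵛ_ x₀) (trans (ev-comb coordinates basis) expansion)) (cancel x₀ x))
      where
      lemma : ∀ u v → u + (v - u) ≡ v
      lemma = solve-∀
      cancel : ∀ {m} (u v : Vec ℤ m) → u +ᵛ (v ⊖ᵛ u) ≡ v
      cancel []       []       = refl
      cancel (u ∷ us) (v ∷ vs) = cong₂ _∷_ (lemma u v) (cancel us vs)

    coordinate-range : norm x ℕ.< k → ∀ d → T (rowCheck d) → InBox (coordinate d)
    coordinate-range x<k d ok = lower , upper
      where
      c M S R D : ℤ
      c = coordinate d
      M = ⟦ bound d ⟧
      R = ⟦ radius ⟧
      S = dot (⟦⟧ˢ (row d)) x₀
      D = dot (⟦⟧ˢ (row d)) x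
      checks = Equivalence.to (T-∧ {entriesBounded (bound d) (row d)}) ok
      checks′ = Equivalence.to (T-∧ {bound d *ᵖ radius +ᵖ (1ℤ ∷ []) ≤ᵖ + 2 ·ᵖ order +ᵖ shiftAt d}) (proj₂ checks)
      S≡ : ⟦ shiftAt d ⟧ ≡ S
      S≡ = trans (⟦dot⟧ (row d) (map toPoly centre)) (cong (dot (⟦⟧ˢ (row d))) (⟦toPoly⟧ˢ centre))
      nc≡ : + n * c ≡ D - S
      nc≡ = trans (n*coordinate d) (dot-- (⟦⟧ˢ (row d)) x x₀)
      entries : All (λ e → + ∣ e ∣ ≤ M) (⟦⟧ˢ (row d))
      entries = entriesBounded-sound (bound d) (row d) (proj₁ checks)
      0≤M : 0ℤ ≤ M
      0≤M with ⟦⟧ˢ (row d) | entries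
      ... | _ ∷ _ | p ∷ _ = ≤-trans (+≤+ z≤n) p
      norm≤R : + norm x ≤ R
      norm≤R = ≤-trans (≤-from-difference
        (i≤j⇒0≤j-i (i<j⇒suc[i]≤j (subst (+ norm x <_) k≡ (+<+ x<k)))) (lemma (+ norm x) (+ a)))
        (≤-reflexive (sym (⟦toPoly⟧ (+ 5 t+ + 2))))
        where
        lemma : ∀ m t → (+ 5 * t + + 2) - m ≡ (+ 5 * t + + 3) - (1ℤ + m)
        lemma = solve-∀
      ∣D∣≤MR : + ∣ D ∣ ≤ M * R
      ∣D∣≤MR = ≤-trans (dot-bound M (⟦⟧ˢ (row d)) x entries) (*-monoˡ-≤-nonNeg M {{nonNegative 0≤M}} norm≤R)
      1≡ : ⟦ 1ℤ ∷ [] ⟧ ≡ 1ℤ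
      1≡ = cong (_+_ 1ℤ) (*-zeroˡ (+ a))
      upper-check : M * R + 1ℤ ≤ + 2 * + n + S
      upper-check = subst₂ _≤_
        (trans (⟦+⟧ (bound d *ᵖ radius) (1ℤ ∷ [])) (cong₂ _+_ (⟦*⟧ (bound d) radius) 1≡))
        (trans (⟦+⟧ (+ 2 ·ᵖ order) (shiftAt d)) (cong₂ _+_ (trans (⟦·⟧ (+ 2) order) (cong (_*_ (+ 2)) (sym n≡))) S≡))
        (⟦≤⟧ (bound d *ᵖ radius +ᵖ (1ℤ ∷ [])) (+ 2 ·ᵖ order +ᵖ shiftAt d) (proj₁ checks′))
      lower-check : - + 3 * + n + S + 1ℤ ≤ - (M * R)
      lower-check = subst₂ _≤_
        (trans (⟦+⟧ (- + 3 ·ᵖ order +ᵖ shiftAt d) (1ℤ ∷ []))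
          (cong₂ _+_ (trans (⟦+⟧ (- + 3 ·ᵖ order) (shiftAt d))
            (cong₂ _+_ (trans (⟦·⟧ (- + 3) order) (cong (_*_ (- + 3)) (sym n≡))) S≡)) 1≡))
        (trans (⟦·⟧ -1ℤ (bound d *ᵖ radius)) (trans (-1*i≡-i _) (cong -_ (⟦*⟧ (bound d) radius))))
        (⟦≤⟧ (- + 3 ·ᵖ order +ᵖ shiftAt d +ᵖ (1ℤ ∷ [])) (-1ℤ ·ᵖ (bound d *ᵖ radius)) (proj₂ checks′))
      -- From n c = D - S ≤ M R - S < 2n; the lower bound is symmetric, with -3n.
      upper : c ≤ + 1
      upper = i<j⇒i≤pred[j] (*-cancelˡ-<-nonNeg (+ n) (subst (_< + n * + 2) (sym nc≡)
        (suc[i]≤j⇒i<j (≤-from-difference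
          (0≤-+ (i≤j⇒0≤j-i upper-check) (i≤j⇒0≤j-i (≤-trans (i≤∣i∣ D) ∣D∣≤MR)))
          (lemma (+ n) D S (M * R))))))
        where
        lemma : ∀ n D S B → n * + 2 - (1ℤ + (D - S)) ≡ (+ 2 * n + S - (B + 1ℤ)) + (B - D)
        lemma = solve-∀
      lower : - + 2 ≤ c
      lower = i<j⇒suc[i]≤j (*-cancelˡ-<-nonNeg (+ n) (subst (+ n * - + 3 <_) (sym nc≡)
        (suc[i]≤j⇒i<j (≤-from-difference
          (0≤-+ (i≤j⇒0≤j-i lower-check) (i≤j⇒0≤j-i (≤-trans (-i≤∣i∣ D) ∣D∣≤MR)))
          (lemma (+ n) D S (M * R))))))
        where
        lemma : ∀ n D S B → D - S - (1ℤ + n * - + 3) ≡ (- B - (- + 3 * n + S + 1ℤ)) + (B - - D)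
        lemma = solve-∀

    coordinates-range : norm x ℕ.< k → All InBox coordinates
    coordinates-range x<k = inBox dual dual-checked
      where
      inBox : ∀ {m} (ds : Vec DualRow m) → All (T ∘ rowCheck) ds → All InBox (map coordinate ds)
      inBox []       []         = []
      inBox (d ∷ ds) (ok ∷ oks) = coordinate-range x<k d ok ∷ inBox ds oks

    k≤norm : k ℕ.≤ norm x
    k≤norm with norm x ℕ.<? k
    ... | no  x≮k = ℕ.≮⇒≥ x≮k
    ... | yes x<k = drop‿+≤+ (begin
      + k                             ≡⟨ k≡ ⟩
      ev (+ 5 t+ + 3)                 ≤⟨ ≤ᶠ-sound (+ 5 t+ + 3) (Σᶠ (map absᶠ fs))
                                          (allBox-sound far far-checked coordinates (coordinates-range x<k)) ⟩
      ev (Σᶠ (map absᶠ fs))           ≤⟨ norm-ev fs ⟩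
      + norm (map ev fs)              ≡⟨ cong (λ v → + norm v) x-expansion ⟩
      + norm x                        ∎)
      where
      open ≤-Reasoning
      fs = zipWith _⊕_ centre (comb coordinates basis)

  hole : Hole k
  hole = dot (tabulate g) x₀ , λ where
    x (≋-intro (divides q q≡)) → Near.k≤norm x q q≡

-- Exactness of the divisions by 3125 and 625.

horner : ℕ → List ℕ → ℕ
horner a []       = 0
horner a (c ∷ cs) = c ℕ.+ horner a cs ℕ.* a

horner-⟦⟧ : ∀ a cs → + horner a cs ≡ PolyEvaluation.⟦_⟧ a (posᵖ cs)
horner-⟦⟧ a []       = refl
horner-⟦⟧ a (c ∷ cs) = cong (_+_ (+ c)) (trans (pos-* (horner a cs) a) (cong (_* + a) (horner-⟦⟧ a cs)))

-- Substitution of x into p by Horner's rule; it turns polynomials in k into polynomials in a.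
compose : Poly → Poly → Poly
compose []      x = []
compose (c ∷ p) x = (c ∷ []) +ᵖ compose p x *ᵖ x

⟦compose⟧ : ∀ a k x → + k ≡ PolyEvaluation.⟦_⟧ a x → ∀ p →
            PolyEvaluation.⟦_⟧ k p ≡ PolyEvaluation.⟦_⟧ a (compose p x)
⟦compose⟧ a k x k≡ []      = refl
⟦compose⟧ a k x k≡ (c ∷ p) = sym (trans (⟦+⟧ (c ∷ []) (compose p x *ᵖ x))
  (cong₂ _+_ (trans (cong (_+_ c) (*-zeroˡ (+ a))) (+-identityʳ c))
    (trans (⟦*⟧ (compose p x) x) (cong₂ _*_ (sym (⟦compose⟧ a k x k≡ p)) (sym k≡)))))
  where open PolyEvaluation a

numeratorL : List ℕ
numeratorL = 1344 ∷ 4180 ∷ 7600 ∷ 6560 ∷ 1280 ∷ 512 ∷ []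

numL-horner : ∀ k → numL k ≡ horner k numeratorL
numL-horner = lemma
  where
  -- Powers and Horner form appear as they reduce, so the lemma fits the goal by computation and the
  -- solver meets only ring operations.
  lemma : ∀ k → 512 ℕ.* (k ℕ.* (k ℕ.* (k ℕ.* (k ℕ.* (k ℕ.* 1))))) ℕ.+ 1280 ℕ.* (k ℕ.* (k ℕ.* (k ℕ.* (k ℕ.* 1))))
    ℕ.+ 6560 ℕ.* (k ℕ.* (k ℕ.* (k ℕ.* 1))) ℕ.+ 7600 ℕ.* (k ℕ.* (k ℕ.* 1)) ℕ.+ 4180 ℕ.* k ℕ.+ 1344
    ≡ 1344 ℕ.+ (4180 ℕ.+ (7600 ℕ.+ (6560 ℕ.+ (1280 ℕ.+ (512 ℕ.+ 0 ℕ.* k) ℕ.* k) ℕ.* k) ℕ.* k) ℕ.* k) ℕ.* k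
  lemma = ℕ-Solver.solve-∀

numeratorG : Fin 5 → Poly
numeratorG zero                         = + 625 ∷ []
numeratorG (suc zero)                   = - + 1557 ∷ - + 1224 ∷ + 1112 ∷ + 64 ∷ + 128 ∷ []
numeratorG (suc (suc zero))             = + 271 ∷ + 1592 ∷ + 2944 ∷ + 448 ∷ + 256 ∷ []
numeratorG (suc (suc (suc zero)))       = + 726 ∷ + 3062 ∷ + 3104 ∷ + 608 ∷ + 256 ∷ []
numeratorG (suc (suc (suc (suc zero)))) = - + 456 ∷ + 2338 ∷ + 4216 ∷ + 672 ∷ + 384 ∷ []

numG-horner : ∀ k t → numG k t ≡ PolyEvaluation.⟦_⟧ k (numeratorG t)
numG-horner k zero = refl
numG-horner k (suc zero) = lemma (+ k)
  where
  lemma : ∀ x → (+ 128 * (x * (x * (x * (x * 1ℤ)))) + + 64 * (x * (x * (x * 1ℤ)))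
      + + 1112 * (x * (x * 1ℤ))) - (+ 1224 * x + + 1557)
    ≡ - + 1557 + (- + 1224 + (+ 1112 + (+ 64 + (+ 128 + 0ℤ * x) * x) * x) * x) * x
  lemma = solve-∀
numG-horner k (suc (suc zero)) = lemma (+ k)
  where
  lemma : ∀ x → + 256 * (x * (x * (x * (x * 1ℤ)))) + + 448 * (x * (x * (x * 1ℤ)))
      + + 2944 * (x * (x * 1ℤ)) + + 1592 * x + + 271
    ≡ + 271 + (+ 1592 + (+ 2944 + (+ 448 + (+ 256 + 0ℤ * x) * x) * x) * x) * x
  lemma = solve-∀
numG-horner k (suc (suc (suc zero))) = lemma (+ k)
  where
  lemma : ∀ x → + 256 * (x * (x * (x * (x * 1ℤ)))) + + 608 * (x * (x * (x * 1ℤ)))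
      + + 3104 * (x * (x * 1ℤ)) + + 3062 * x + + 726
    ≡ + 726 + (+ 3062 + (+ 3104 + (+ 608 + (+ 256 + 0ℤ * x) * x) * x) * x) * x
  lemma = solve-∀
numG-horner k (suc (suc (suc (suc zero)))) = lemma (+ k)
  where
  lemma : ∀ x → (+ 384 * (x * (x * (x * (x * 1ℤ)))) + + 672 * (x * (x * (x * 1ℤ)))
      + + 4216 * (x * (x * 1ℤ)) + + 2338 * x) - + 456
    ≡ - + 456 + (+ 2338 + (+ 4216 + (+ 672 + (+ 384 + 0ℤ * x) * x) * x) * x) * x
  lemma = solve-∀

diameterᵖ : Poly
diameterᵖ = toPoly (+ 5 t+ + 3)

-- Here the congruence k ≡ 3 mod 5 enters: after the substitution every coefficient is a multiple of
-- 3125.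
order-exact : T (compose (posᵖ numeratorL) diameterᵖ ≡ᵖ + 3125 ·ᵖ order)
order-exact = _

generators-exact : ∀ t → T (compose (numeratorG t) diameterᵖ ≡ᵖ + 625 ·ᵖ posᵖ (generatorCoefficients t))
generators-exact zero                         = _
generators-exact (suc zero)                   = _
generators-exact (suc (suc zero))             = _
generators-exact (suc (suc (suc zero)))       = _
generators-exact (suc (suc (suc (suc zero)))) = _

module Exact (a k : ℕ) (k≡ : + k ≡ Evaluation.ev a (+ 5 t+ + 3)) where
  open PolyEvaluation a

  compose-exact : ∀ p c cs → T (compose p diameterᵖ ≡ᵖ + c ·ᵖ posᵖ cs) →
                  PolyEvaluation.⟦_⟧ k p ≡ + (horner a cs ℕ.* c)
  compose-exact p c cs ok =
    trans (⟦compose⟧ a k diameterᵖ (trans k≡ (sym (⟦toPoly⟧ (+ 5 t+ + 3)))) p)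
    (trans (⟦≡⟧ (compose p diameterᵖ) (+ c ·ᵖ posᵖ cs) ok)
    (trans (⟦·⟧ (+ c) (posᵖ cs))
    (trans (cong (_*_ (+ c)) (sym (horner-⟦⟧ a cs)))
    (trans (*-comm (+ c) (+ horner a cs)) (sym (pos-* (horner a cs) c))))))

  numL≡ : numL k ≡ horner a orderCoefficients ℕ.* 3125
  numL≡ = +-injective (trans (cong (λ e → + e) (numL-horner k))
    (trans (horner-⟦⟧ k numeratorL) (compose-exact (posᵖ numeratorL) 3125 orderCoefficients order-exact)))

  LCC10≡ : LCC10 k ≡ horner a orderCoefficients
  LCC10≡ = trans (cong (ℕ._/ 3125) numL≡) (ℕ.m*n/n≡m (horner a orderCoefficients) 3125)

  numG≡ : ∀ t → numG k t ≡ + (horner a (generatorCoefficients t) ℕ.* 625)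
  numG≡ t = trans (numG-horner k t) (compose-exact (numeratorG t) 625 (generatorCoefficients t) (generators-exact t))

  -- In terms of a the numerators are nonnegative multiples of 625, so integer division becomes
  -- exact division of naturals.
  gen≡ : ∀ t → gen k t ≡ + horner a (generatorCoefficients t)
  gen≡ t = trans (cong (ℤ._/ + 625) (numG≡ t))
    (trans (div-pos-is-/ℕ (+ (horner a (generatorCoefficients t) ℕ.* 625)) 625)
      (cong (λ e → + e) (ℕ.m*n/n≡m (horner a (generatorCoefficients t)) 625)))

  generators≡ : tabulate (gen k) ≡ ⟦⟧ˢ generators
  generators≡ = trans (tabulate-cong (λ t → trans (gen≡ t) (horner-⟦⟧ a (generatorCoefficients t))))
    (tabulate-∘ ⟦_⟧ (posᵖ ∘ generatorCoefficients))

-- The covering for k = 3 by enumeration.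

ball : ∀ m → ℕ → List (Vec ℤ m)
ball zero    d = [] ∷ []
ball (suc m) d = List.map (0ℤ ∷_) (ball m d) ++ shells d
  where
  shells : ℕ → List (Vec ℤ (suc m))
  shells zero    = []
  -- First coordinate ±(d - e), which leaves norm e for the others.
  shells (suc e) = List.map (+ suc e′ ∷_) (ball m e) ++ List.map (-[1+ e′ ] ∷_) (ball m e) ++ shells e
    where e′ = d ℕ.∸ suc e

-- The trees need a ≥ 1; for k = 3 the group has 156 elements and the ball 231.
generators₃ : Vec ℤ 5
generators₃ = + 1 ∷ + 27 ∷ + 103 ∷ + 120 ∷ + 150 ∷ []

residue : Vec ℤ 5 → ℕ
residue x = dot generators₃ x %ℕ 156

reached : ℕ → Bool
reached r = any (r ℕ.≡ᵇ_) (List.map residue (ball 5 3))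

-- With `reached`, this makes the list a certificate: only residues and norms are read off, not how
-- it was generated.
short : Vec ℤ 5 → Bool
short x = norm x ℕ.≤ᵇ 3

reached-checked : T (all reached (upTo 156))
reached-checked = _

short-checked : T (all short (ball 5 3))
short-checked = _

covering₃ : ∀ (g : Fin 5 → ℤ) → tabulate g ≡ generators₃ → Cayley.Covering 156 g 3
covering₃ g g≡ z = x , ℕ.≤ᵇ⇒≤ (norm x) 3 (proj₁ found) ,
    subst (λ v → dot v x ≋ z) (sym g≡)
      (≋-trans (≋-sym (%ℕ-≋ (dot generators₃ x)))
        (subst (λ r → + r ≋ z) (ℕ.≡ᵇ⇒≡ (z %ℕ 156) (residue x) (proj₂ found)) (%ℕ-≋ z)))
  where
  open Cayley 156 g
  hit : ListAny.Any (λ x → T (z %ℕ 156 ℕ.≡ᵇ residue x)) (ball 5 3)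
  hit = ListAny.map⁻ (ListAny.any⁻ (z %ℕ 156 ℕ.≡ᵇ_) (List.map residue (ball 5 3))
    (ListAll.lookup (ListAll.all⁺ reached (upTo 156) reached-checked) (∈-upTo⁺ (n%ℕd<d z 156))))
  x : Vec ℤ 5
  x = ListAny.lookup hit
  found : T (short x) × T (z %ℕ 156 ℕ.≡ᵇ residue x)
  found = ListAll.lookupAny (ListAll.all⁺ short (ball 5 3) short-checked) hit

-- The diameter for k = 5a + 3, and for every k ≡ 3 mod 5.

diameter-≡ : ∀ a → + (3 ℕ.+ a ℕ.* 5) ≡ Evaluation.ev a (+ 5 t+ + 3)
diameter-≡ a = trans (cong (_+_ (+ 3)) (pos-* a 5)) (lemma (+ a))
  where
  lemma : ∀ a → + 3 + a * + 5 ≡ + 5 * a + + 3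
  lemma = solve-∀

-- Only the upper bound treats a = 0 apart; the deep hole is uniform in a.
covering : ∀ a → Cayley.Covering (horner a orderCoefficients) (gen (3 ℕ.+ a ℕ.* 5)) (3 ℕ.+ a ℕ.* 5)
covering zero    = covering₃ (gen 3) refl
covering (suc b) = Cover.covering-holds b (horner (suc b) orderCoefficients) k (gen k)
    (horner-⟦⟧ (suc b) orderCoefficients) (Exact.generators≡ (suc b) k (diameter-≡ (suc b)))
    (trans (diameter-≡ (suc b)) (lemma (+ b)))
  where
  k = 3 ℕ.+ suc b ℕ.* 5
  lemma : ∀ b → + 5 * (1ℤ + b) + + 3 ≡ + 5 * b + + 8
  lemma = solve-∀

theorem8-at : ∀ a → let k = 3 ℕ.+ a ℕ.* 5 in
  (3125 ℕ.* LCC10 k ≡ numL k)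
  × ((t : Fin 5) → + 625 Unsigned.∣ numG k t)
  × HasDiameter (LCC10 k) (gen k) k
theorem8-at a =
    trans (cong (3125 ℕ.*_) LCC10≡) (trans (ℕ.*-comm 3125 n) (sym numL≡)) ,
    (λ t → ∣⇒∣ᵤ (divides (+ horner a (generatorCoefficients t))
      (trans (numG≡ t) (pos-* (horner a (generatorCoefficients t)) 625)))) ,
    subst (λ n → HasDiameter n (gen k) k) (sym LCC10≡) (hasDiameter (covering a)
      (DeepHole.hole a n k (gen k) (horner-⟦⟧ a orderCoefficients) generators≡ (diameter-≡ a)))
  where
  k n : ℕ
  k = 3 ℕ.+ a ℕ.* 5
  n = horner a orderCoefficients
  open Exact a k (diameter-≡ a)
  open Cayley n (gen k)

theorem8 : (k : ℕ) → 0 ℕ.< k → k ℕ.% 5 ≡ 3 →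
    (3125 ℕ.* LCC10 k ≡ numL k)
    × ((t : Fin 5) → + 625 Unsigned.∣ numG k t)
    × HasDiameter (LCC10 k) (gen k) k
theorem8 k _ k%5≡3 = subst
  (λ k → (3125 ℕ.* LCC10 k ≡ numL k) × ((t : Fin 5) → + 625 Unsigned.∣ numG k t) × HasDiameter (LCC10 k) (gen k) k)
  -- Division with remainder gives k = 3 + (k / 5) · 5, hence a = k / 5.
  (sym (trans (ℕ.m≡m%n+[m/n]*n k 5) (cong (ℕ._+ k ℕ./ 5 ℕ.* 5) k%5≡3)))
  (theorem8-at (k ℕ./ 5))
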